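{- Let $D_S$ be a digraph with self-loops of order $n$ with $\sigma$ self-loops ($0\le\sigma\le n$), and let $\overline{D_S}$ be its complement. Let $\rho$ and $\overline\rho$ be the spectral radii of $D_S$ and $\overline{D_S}$ respectively, and let $c_2$ and $\overline{c_2}$ be the numbers defined in the context for $D_S$ and $\overline{D_S}$ respectively. Then $$1-\delta_\sigma+\frac{c_2+\overline{c_2}}{n}\le\rho+\overline\rho\le1-\delta_\sigma+\sqrt{(n-1)^2-\frac{4\sigma(n-\sigma)}{n^2}+\frac{4\sigma(n-\sigma)}{n}+\frac{(n-1)(c_2+\overline{c_2})}{n}}.$$
   Context: A digraph with self-loops $D_S$ is a pair $(V,\mathcal A)$ with $V$ a nonempty finite vertex set and $\mathcal A\subseteq V\times V$ a set of arcs; $S=\{v\in V:(v,v)\in\mathcal A\}$ is the self-loop set (possibly empty). The order is $n=|V|$ and $\sigma=|S|$. The adjacency matrix $A(D_S)=(a_{ij})$ has $a_{ij}=1$ if $(v_i,v_j)\in\mathcal A$ and $0$ otherwise; the spectral radius of the digraph is that of its adjacency matrix. For a digraph with self-loops, $c_2$ is the number of closed walks $vwv$ with $v\ne w$, i.e. the number of ordered pairs $(v,w)$ with $v\ne w$ such that both $(v,w)$ and $(w,v)$ are arcs; $\overline{c_2}$ is this number for $\overline{D_S}$. Put $\delta_\sigma=1$ if $\sigma=0$ and $\delta_\sigma=0$ if $\sigma\ne0$. The complement $\overline{D_S}$ is the digraph with self-loops on $V$ with adjacency matrix $A(\overline{D_S})=J_n-\delta_\sigma I_n-A(D_S)$,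 where $J_n$ is the all-ones matrix and $I_n$ the identity matrix. -}

module Defs where

open import Algebra.Bundles using (CommutativeRing; RawMonoid)
import Algebra.Definitions.RawMonoid as RawMonoidDefinitions
import Algebra.Properties.Ring as RingProperties
open import Data.Bool.Base using (Bool; true; false; not; _∧_; if_then_else_)
open import Data.Fin.Base using (Fin; zero; suc)
open import Data.Fin.Properties using (_≟_)
open import Data.Fin.Subset using (Subset; ∣_∣)
open import Data.Nat.Base as ℕ using (ℕ; zero; suc)
import Data.Nat.Properties as ℕ
open import Data.Product.Base using (∃-syntax; Σ-syntax; _×_)
open import Data.Vec.Base using (tabulate)
open import Level using (0ℓ) renaming (suc to ℓsuc)
open import Relation.Binary.PropositionalEquality.Core as ≡ using (_≡_)
open import Relation.Binary.Structures using (IsDecTotalOrder)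
open import Relation.Nullary using (¬_; does; yes; no; contradiction)

------------------------------------------------------------------------
-- Digraphs with self-loops

-- The vertex set is Fin n, the vertices v₁, …, vₙ being the ones that
-- index the adjacency matrix. Arcs form an arbitrary subset of
-- Fin n × Fin n, given by its characteristic function.

record Digraph (n : ℕ) : Set where
  constructor digraph
  field
    arc : Fin n → Fin n → Bool

open Digraph public

module _ {n : ℕ} where

  loops : Digraph n → Subset n
  loops D = tabulate λ v → arc D v v

  σ : Digraph n → ℕ
  σ D = ∣ loops D ∣

  mutualNeighbours : Digraph n → Fin n → Subset n
  mutualNeighbours D v =
    tabulate λ w → not (does (v ≟ w)) ∧ (arc D v w ∧ arc D w v)

  -- The number of ordered pairs (v , w) with v ≢ w such that both
  -- (v , w) and (w , v) are arcs, counted by first component.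

  c₂ : Digraph n → ℕ
  c₂ D = sum λ v → ∣ mutualNeighbours D v ∣
    where open RawMonoidDefinitions ℕ.+-0-rawMonoid using (sum)

  δ : Digraph n → ℕ
  δ D = if σ D ℕ.≡ᵇ 0 then 1 else 0

  -- If there are no self-loops, the diagonal stays empty; otherwise every
  -- pair, on or off the diagonal, is switched. In terms of adjacency
  -- matrices this is J - δ I - A, see adjacency-complement below.

  complement : Digraph n → Digraph n
  arc (complement D) v w =
    not (arc D v w) ∧ not ((σ D ℕ.≡ᵇ 0) ∧ does (v ≟ w))

------------------------------------------------------------------------
-- The real numbers

-- The field ℝ up to isomorphism: a totally ordered field in which every
-- nonempty subset that is bounded above has a supremum. As in classical
-- mathematics, equality and order are decidable. Inversion is total, its
-- value at 0# being unconstrained.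

record Reals : Set₁ where
  infix  4 _≤_
  infix  8 _⁻¹ _²
  infixl 7 _/_

  field
    commutativeRing : CommutativeRing 0ℓ 0ℓ

  open CommutativeRing commutativeRing public

  field
    _⁻¹             : Carrier → Carrier
    _≤_             : Carrier → Carrier → Set
    0≉1             : ¬ (0# ≈ 1#)
    ⁻¹-inverseʳ     : ∀ x → ¬ (x ≈ 0#) → x * x ⁻¹ ≈ 1#
    isDecTotalOrder : IsDecTotalOrder _≈_ _≤_
    +-monoˡ-≤       : ∀ z {x y} → x ≤ y → x + z ≤ y + z
    *-nonNeg        : ∀ {x y} → 0# ≤ x → 0# ≤ y → 0# ≤ x * y
    supremum        : (P : Carrier → Set) →
                      ∃[ x ] P x →
                      ∃[ b ] (∀ x → P x → x ≤ b) →
                      ∃[ s ] ((∀ x → P x → x ≤ s) ×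
                              (∀ b → (∀ x → P x → x ≤ b) → s ≤ b))

  _/_ : Carrier → Carrier → Carrier
  x / y = x * y ⁻¹

  _² : Carrier → Carrier
  x ² = x * x

  fromℕ : ℕ → Carrier
  fromℕ k = k ×ℕ 1#
    where open RawMonoidDefinitions +-rawMonoid renaming (_×_ to _×ℕ_)

  IsSqrt : Carrier → Carrier → Set
  IsSqrt x s = 0# ≤ s × s ² ≈ x

------------------------------------------------------------------------
-- Complex numbers, eigenvalues and the spectral radius

Matrix : Set → ℕ → Set
Matrix A n = Fin n → Fin n → A

module Spectral (ℝ : Reals) where
  open Reals ℝ hiding (zero)

  record ℂ : Set where
    constructor _+i_
    field
      re im : Carrier

  open ℂ public

  infix  4 _≈ᶜ_
  infixl 6 _+ᶜ_
  infixl 7 _*ᶜ_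

  _≈ᶜ_ : ℂ → ℂ → Set
  z ≈ᶜ w = re z ≈ re w × im z ≈ im w

  0ᶜ : ℂ
  0ᶜ = 0# +i 0#

  _+ᶜ_ _*ᶜ_ : ℂ → ℂ → ℂ
  z +ᶜ w = (re z + re w) +i (im z + im w)
  z *ᶜ w = (re z * re w - im z * im w) +i (re z * im w + im z * re w)

  fromReal : Carrier → ℂ
  fromReal x = x +i 0#

  +ᶜ-rawMonoid : RawMonoid 0ℓ 0ℓ
  +ᶜ-rawMonoid = record { Carrier = ℂ ; _≈_ = _≈ᶜ_ ; _∙_ = _+ᶜ_ ; ε = 0ᶜ }

  open RawMonoidDefinitions +ᶜ-rawMonoid public using () renaming (sum to sumᶜ)

  IsModulus : ℂ → Carrier → Set
  IsModulus z r = IsSqrt (re z ² + im z ²) r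

  IsEigenvalue : ∀ {n} → Matrix ℂ n → ℂ → Set
  IsEigenvalue {n} M z =
    Σ[ x ∈ (Fin n → ℂ) ] (∃[ i ] ¬ (x i ≈ᶜ 0ᶜ)) ×
      (∀ i → sumᶜ (λ j → M i j *ᶜ x j) ≈ᶜ z *ᶜ x i)

  IsSpectralRadius : ∀ {n} → Matrix ℂ n → Carrier → Set
  IsSpectralRadius M ρ =
    (∃[ z ] IsEigenvalue M z × IsModulus z ρ) ×
    (∀ z r → IsEigenvalue M z → IsModulus z r → r ≤ ρ)

  adjacency : ∀ {n} → Digraph n → Matrix Carrier n
  adjacency D i j = if arc D i j then 1# else 0#

  IsDigraphSpectralRadius : ∀ {n} → Digraph n → Carrier → Set
  IsDigraphSpectralRadius D =
    IsSpectralRadius (λ i j → fromReal (adjacency D i j))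

  ----------------------------------------------------------------------
  -- The complement has adjacency matrix J - δ I - A

  identity allOnes : ∀ {n} → Matrix Carrier n
  identity i j = if does (i ≟ j) then 1# else 0#
  allOnes  i j = 1#

  private
    open RingProperties ring using (-0#≈0#)

    empty⇒false : ∀ {n} (f : Fin n → Bool) → ∣ tabulate f ∣ ≡ 0 →
                  ∀ i → f i ≡ false
    empty⇒false {suc n} f eq i       with f zero in eq₀
    empty⇒false {suc n} f () i       | true
    empty⇒false {suc n} f eq zero    | false = eq₀
    empty⇒false {suc n} f eq (suc i) | false =
      empty⇒false (λ j → f (suc j)) eq i

    1-0-0 : ∀ {x} → x ≈ 0# → 1# ≈ 1# - x - 0#
    1-0-0 x≈0 = sym (trans (+-cong (+-congˡ (-‿cong x≈0)) -0#≈0#)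
      (trans (+-identityʳ _) (trans (+-congˡ -0#≈0#) (+-identityʳ _))))

    1-0-1 : ∀ {x} → x ≈ 0# → 0# ≈ 1# - x - 1#
    1-0-1 x≈0 = sym (trans
      (+-congʳ (trans (+-congˡ (trans (-‿cong x≈0) -0#≈0#)) (+-identityʳ _)))
      (-‿inverseʳ 1#))

    1-1-0 : ∀ {x} → x ≈ 1# → 0# ≈ 1# - x - 0#
    1-1-0 x≈1 = sym (trans (+-cong (+-congˡ (-‿cong x≈1)) -0#≈0#)
      (trans (+-identityʳ _) (-‿inverseʳ 1#)))

  adjacency-complement : ∀ {n} (D : Digraph n) i j →
    adjacency (complement D) i j ≈
    allOnes i j - fromℕ (δ D) * identity i j - adjacency D i j
  adjacency-complement D i j with σ D in eq
  adjacency-complement D i j | suc _ with arc D i j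
  ... | true  = 1-0-1 (zeroˡ _)
  ... | false = 1-0-0 (zeroˡ _)
  adjacency-complement D i j | zero with i ≟ j
  ... | yes ≡.refl with arc D i i | empty⇒false (λ v → arc D v v) eq i
  ...   | false | _ = 1-1-0 (trans (*-identityʳ _) (+-identityʳ 1#))
  adjacency-complement D i j | zero | no _ with arc D i j
  ... | true  = 1-0-1 (zeroʳ _)
  ... | false = 1-0-0 (zeroʳ _)

{-# OPTIONS --safe #-}

-- Write A for the adjacency matrix, N for the order and s for the number of loops.
--
-- Upper bound. If x is an eigenvector for an eigenvalue of modulus ρ, then
-- y = |x| satisfies ρ y ≤ A y, so that ρ ≤ ⟨A , P⟩ for P = y yᵀ / |y|². Hence
-- 2 (ρ - s / N) ≤ ⟨A + Aᵀ - (2 s / N) I , P - I / N⟩. The second matrix has squared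
-- Frobenius norm 1 - 1 / N and that of the first one is a polynomial in s, c₂ and
-- the number of arcs. Cauchy–Schwarz is applied once to the pair formed by D and
-- its complement, whose numbers of loops and of arcs add up to known values.
--
-- Lower bound. It suffices that ρ ≥ (c₂ + s) / N. Call t admissible if A v ≤ t v for
-- some v > 0. For the symmetric matrix S i j = A i j * A j i ≤ A i j, the inequality
-- 2 ≤ v j / v i + v i / v j shows that the entries of S, whose sum is c₂ + s, add up
-- to at most N t for each admissible t. The infimum t₀ of the admissible t is at most
-- ρ: otherwise t₀ is no eigenvalue, the solution y of t₀ y - A y = 1 is positive by
-- comparison with admissible t close to t₀, and y shows that t₀ - ε is admissible.

module Submission where

open import Defs
open import Algebra.Bundles using (RawRing)
import Algebra.Definitions.RawMonoid as RawMonoidDefinitions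
import Algebra.Properties.Monoid.Mult.TCOptimised as MultTC
import Algebra.Properties.Ring as RingProperties
import Algebra.Properties.Semiring.Mult as SemiringMult
import Algebra.Properties.Semiring.Sum as SemiringSum
import Algebra.Solver.CommutativeMonoid as CommutativeMonoidSolver
import Algebra.Solver.Ring as RingSolver
open import Algebra.Solver.Ring.AlmostCommutativeRing
  using (AlmostCommutativeRing; _-Raw-AlmostCommutative⟶_; fromCommutativeRing)
open import Data.Bool.Base using (Bool; true; false; not; _∧_; if_then_else_)
open import Data.Fin.Base using (Fin; zero; suc; punchIn)
import Data.Fin.Properties as Fin
open import Data.Fin.Subset using (∣_∣)
open import Data.Maybe.Base using (Maybe; just; nothing)
open import Data.Nat.Base as ℕ using (ℕ; zero; suc; NonZero)
import Data.Nat.Properties as ℕ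
open import Data.Product.Base using (∃-syntax; _×_; _,_; proj₁; proj₂)
open import Data.Product.Properties using (≡-dec)
open import Data.Sum.Base using (_⊎_; inj₁; inj₂)
open import Data.Vec.Base using (tabulate)
open import Data.Vec.Functional using (_∷_; insertAt)
open import Data.Vec.Functional.Properties using (insertAt-lookup; insertAt-punchIn)
open import Function.Base using (_∘_)
open import Level using (0ℓ)
open import Relation.Binary.Bundles using (Poset)
open import Relation.Binary.PropositionalEquality.Core as ≡ using (_≡_)
import Relation.Binary.Reasoning.PartialOrder as PosetReasoning
import Relation.Binary.Reasoning.Setoid as SetoidReasoning
open import Relation.Binary.Structures using (IsDecTotalOrder)
open import Relation.Nullary using (¬_; does; yes; no; contradiction)
open import Relation.Nullary.Decidable using (¬?; decidable-stable)

-- A ring solver with integer coefficients for the real field.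

module IntegerSolver (ℝ : Reals) where
  open Reals ℝ
  open SemiringMult semiring using (×-homo-+; ×1-homo-*) renaming (_×_ to _×ℕ_)
  open RawMonoidDefinitions +-rawMonoid using (_×′_)
  open MultTC +-monoid using (×ᵤ≈×)
  open RingProperties ring
  open SetoidReasoning setoid

  -- The integer a − b is represented by (a ∸ b , b ∸ a); the solver compares
  -- coefficients up to definitional equality, hence the normalisation.
  difference : ℕ → ℕ → ℕ × ℕ
  difference a b = a ℕ.∸ b , b ℕ.∸ a

  ℤ′ : RawRing 0ℓ 0ℓ
  ℤ′ = record
    { Carrier = ℕ × ℕ
    ; _≈_     = _≡_
    ; _+_     = λ (a , b) (c , d) → difference (a ℕ.+ c) (b ℕ.+ d)
    ; _*_     = λ (a , b) (c , d) →
        difference (a ℕ.* c ℕ.+ b ℕ.* d) (a ℕ.* d ℕ.+ b ℕ.* c)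
    ; -_      = λ (a , b) → b , a
    ; 0#      = 0 , 0
    ; 1#      = 1 , 0
    }

  -- A zero second component is dropped and `_×′_` adds no trailing `0#`, so that `(0 , 0)` and
  -- `(1 , 0)` evaluate definitionally to `0#` and `1#`.
  ⟦_⟧ : ℕ × ℕ → Carrier
  ⟦ a , zero ⟧  = a ×′ 1#
  ⟦ a , suc b ⟧ = a ×′ 1# - suc b ×′ 1#

  ⟦⟧-pair : ∀ a b → ⟦ a , b ⟧ ≈ a ×ℕ 1# - b ×ℕ 1#
  ⟦⟧-pair a zero    = sym (trans (+-cong (×ᵤ≈× a 1#) -0#≈0#) (+-identityʳ _))
  ⟦⟧-pair a (suc b) = sym (+-cong (×ᵤ≈× a 1#) (-‿cong (×ᵤ≈× (suc b) 1#)))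

  open CommutativeMonoidSolver +-commutativeMonoid using (_⊕_; _⊜_) renaming (solve to permute)

  difference-homo : ∀ a b → ⟦ difference a b ⟧ ≈ a ×ℕ 1# - b ×ℕ 1#
  difference-homo zero    zero    = ⟦⟧-pair 0 0
  difference-homo zero    (suc b) = ⟦⟧-pair 0 (suc b)
  difference-homo (suc a) zero    = ⟦⟧-pair (suc a) 0
  difference-homo (suc a) (suc b) = begin
    ⟦ difference a b ⟧                ≈⟨ difference-homo a b ⟩
    A - B                             ≈⟨ +-identityˡ _ ⟨
    0# + (A - B)                      ≈⟨ +-congʳ (-‿inverseʳ 1#) ⟨
    (1# - 1#) + (A - B)
      ≈⟨ permute 4 (λ x y z w → (x ⊕ y) ⊕ (z ⊕ w) ⊜ (x ⊕ z) ⊕ (y ⊕ w)) refl _ _ _ _ ⟩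
    (1# + A) + (- 1# - B)             ≈⟨ +-congˡ (-‿+-comm 1# B) ⟩
    (1# + A) - (1# + B)               ∎
    where
    A B : Carrier
    A = a ×ℕ 1#
    B = b ×ℕ 1#

  ⟦⟧-+-homo : ∀ p q → ⟦ RawRing._+_ ℤ′ p q ⟧ ≈ ⟦ p ⟧ + ⟦ q ⟧
  ⟦⟧-+-homo (a , b) (c , d) = begin
    ⟦ difference (a ℕ.+ c) (b ℕ.+ d) ⟧
      ≈⟨ difference-homo (a ℕ.+ c) (b ℕ.+ d) ⟩
    (a ℕ.+ c) ×ℕ 1# - (b ℕ.+ d) ×ℕ 1#
      ≈⟨ +-cong (×-homo-+ 1# a c) (trans (-‿cong (×-homo-+ 1# b d)) (sym (-‿+-comm _ _))) ⟩
    (a ×ℕ 1# + c ×ℕ 1#) + (- (b ×ℕ 1#) - d ×ℕ 1#)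
      ≈⟨ permute 4 (λ A B C D → (A ⊕ C) ⊕ (B ⊕ D) ⊜ (A ⊕ B) ⊕ (C ⊕ D)) refl _ _ _ _ ⟩
    (a ×ℕ 1# - b ×ℕ 1#) + (c ×ℕ 1# - d ×ℕ 1#)
      ≈⟨ +-cong (⟦⟧-pair a b) (⟦⟧-pair c d) ⟨
    ⟦ a , b ⟧ + ⟦ c , d ⟧ ∎

  ⟦⟧-*-homo : ∀ p q → ⟦ RawRing._*_ ℤ′ p q ⟧ ≈ ⟦ p ⟧ * ⟦ q ⟧
  ⟦⟧-*-homo (a , b) (c , d) = begin
    ⟦ difference (a ℕ.* c ℕ.+ b ℕ.* d) (a ℕ.* d ℕ.+ b ℕ.* c) ⟧
      ≈⟨ difference-homo (a ℕ.* c ℕ.+ b ℕ.* d) (a ℕ.* d ℕ.+ b ℕ.* c) ⟩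
    (a ℕ.* c ℕ.+ b ℕ.* d) ×ℕ 1# - (a ℕ.* d ℕ.+ b ℕ.* c) ×ℕ 1#
      ≈⟨ +-cong (homo a c b d) (trans (-‿cong (homo a d b c)) (sym (-‿+-comm _ _))) ⟩
    (A * C + B * D) + (- (A * D) - B * C)
      ≈⟨ +-cong (+-congˡ (trans (sym (-‿involutive _)) (trans (-‿cong (-‿distribʳ-* B D)) (-‿distribˡ-* B (- D)))))
                (+-cong (-‿distribʳ-* A D) (-‿distribˡ-* B C)) ⟩
    (A * C + - B * - D) + (A * - D + - B * C)
      ≈⟨ permute 4 (λ x y z w → (x ⊕ y) ⊕ (z ⊕ w) ⊜ (x ⊕ z) ⊕ (w ⊕ y)) refl _ _ _ _ ⟩
    (A * C + A * - D) + (- B * C + - B * - D)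
      ≈⟨ +-cong (distribˡ A C (- D)) (distribˡ (- B) C (- D)) ⟨
    A * (C - D) + - B * (C - D)
      ≈⟨ distribʳ (C - D) A (- B) ⟨
    (A - B) * (C - D)
      ≈⟨ *-cong (⟦⟧-pair a b) (⟦⟧-pair c d) ⟨
    ⟦ a , b ⟧ * ⟦ c , d ⟧ ∎
    where
    A B C D : Carrier
    A = a ×ℕ 1#
    B = b ×ℕ 1#
    C = c ×ℕ 1#
    D = d ×ℕ 1#

    homo : ∀ k l m n → (k ℕ.* l ℕ.+ m ℕ.* n) ×ℕ 1# ≈
           (k ×ℕ 1#) * (l ×ℕ 1#) + (m ×ℕ 1#) * (n ×ℕ 1#)
    homo k l m n = trans (×-homo-+ 1# (k ℕ.* l) (m ℕ.* n)) (+-cong (×1-homo-* k l) (×1-homo-* m n))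

  ⟦⟧-‿homo : ∀ p → ⟦ RawRing.-_ ℤ′ p ⟧ ≈ - ⟦ p ⟧
  ⟦⟧-‿homo (a , b) = begin
    ⟦ b , a ⟧                    ≈⟨ ⟦⟧-pair b a ⟩
    b ×ℕ 1# - a ×ℕ 1#            ≈⟨ ⁻¹-anti-homo‿- (a ×ℕ 1#) (b ×ℕ 1#) ⟨
    - (a ×ℕ 1# - b ×ℕ 1#)        ≈⟨ -‿cong (⟦⟧-pair a b) ⟨
    - ⟦ a , b ⟧                  ∎

  ⟦⟧-≟ : ∀ p q → Maybe (⟦ p ⟧ ≈ ⟦ q ⟧)
  ⟦⟧-≟ p q with ≡-dec ℕ._≟_ ℕ._≟_ p q
  ... | yes p≡q = just (reflexive (≡.cong ⟦_⟧ p≡q))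
  ... | no  _   = nothing

  almostCommutativeRing : AlmostCommutativeRing 0ℓ 0ℓ
  almostCommutativeRing = fromCommutativeRing commutativeRing

  ℤ′⟶ℝ : ℤ′ -Raw-AlmostCommutative⟶ almostCommutativeRing
  ℤ′⟶ℝ = record
    { ⟦_⟧    = ⟦_⟧
    ; +-homo = ⟦⟧-+-homo
    ; *-homo = ⟦⟧-*-homo
    ; -‿homo = ⟦⟧-‿homo
    ; 0-homo = refl
    ; 1-homo = refl
    }

  open RingSolver ℤ′ almostCommutativeRing ℤ′⟶ℝ ⟦⟧-≟ public
    using (Polynomial; solve; con; _:=_; _:+_; _:*_; _:-_; :-_)

  -- `four` has the shape to which `fromℕ 4` unfolds, so that solver identities in `four` match
  -- goals in `fromℕ 4`.
  𝟘 𝟙 four : ∀ {n} → Polynomial n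
  𝟘 = con (0 , 0)
  𝟙 = con (1 , 0)
  four = 𝟙 :+ (𝟙 :+ (𝟙 :+ (𝟙 :+ 𝟘)))

-- Ordered field arithmetic and square roots.

module OrderedField (ℝ : Reals) where
  open Reals ℝ public hiding (zero)
  open RingProperties ring public using (x∙y⁻¹≈ε⇒x≈y)
  open IntegerSolver ℝ public
  open IsDecTotalOrder isDecTotalOrder public
    using (_≤?_; _≟_; antisym; ≤-respʳ-≈; ≤-respˡ-≈)
    renaming (refl to ≤-refl; reflexive to ≤-reflexive; trans to ≤-trans; total to ≤-total)

  poset : Poset 0ℓ 0ℓ 0ℓ
  poset = record { isPartialOrder = IsDecTotalOrder.isPartialOrder isDecTotalOrder }

  module ≤-Reasoning = PosetReasoning poset
  open ≤-Reasoning

  infix 4 _<_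

  -- By totality and antisymmetry this is the usual strict order; a proof of `x < y` is a function
  -- that refutes `y ≤ x`.
  _<_ : Carrier → Carrier → Set
  x < y = ¬ (y ≤ x)

  ≤-stable : ∀ {x y} → ¬ ¬ (x ≤ y) → x ≤ y
  ≤-stable = decidable-stable (_ ≤? _)

  <⇒≤ : ∀ {x y} → x < y → x ≤ y
  <⇒≤ {x} {y} x<y with ≤-total x y
  ... | inj₁ x≤y = x≤y
  ... | inj₂ y≤x = contradiction y≤x x<y

  <⇒≉0 : ∀ {x} → 0# < x → ¬ (x ≈ 0#)
  <⇒≉0 0<x x≈0 = 0<x (≤-reflexive x≈0)

  ≤∧≉0⇒< : ∀ {x} → 0# ≤ x → ¬ (x ≈ 0#) → 0# < x
  ≤∧≉0⇒< 0≤x x≉0 x≤0 = x≉0 (antisym x≤0 0≤x)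

  <-≤-trans : ∀ {x y z} → x < y → y ≤ z → x < z
  <-≤-trans x<y y≤z z≤x = x<y (≤-trans y≤z z≤x)

  ≤-<-trans : ∀ {x y z} → x ≤ y → y < z → x < z
  ≤-<-trans x≤y y<z z≤x = y<z (≤-trans z≤x x≤y)

  +-mono-≤ : ∀ {x y u v} → x ≤ y → u ≤ v → x + u ≤ y + v
  +-mono-≤ {x} {y} {u} {v} x≤y u≤v = begin
    x + u  ≤⟨ +-monoˡ-≤ u x≤y ⟩
    y + u  ≈⟨ +-comm y u ⟩
    u + y  ≤⟨ +-monoˡ-≤ y u≤v ⟩
    v + y  ≈⟨ +-comm v y ⟩
    y + v  ∎

  +-nonNeg : ∀ {x y} → 0# ≤ x → 0# ≤ y → 0# ≤ x + y
  +-nonNeg 0≤x 0≤y = ≤-respˡ-≈ (+-identityʳ 0#) (+-mono-≤ 0≤x 0≤y)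

  ≤⇒0≤- : ∀ {x y} → x ≤ y → 0# ≤ y - x
  ≤⇒0≤- {x} {y} x≤y = ≤-respˡ-≈ (-‿inverseʳ x) (+-monoˡ-≤ (- x) x≤y)

  infix 3 _by_

  -- The form of most inequality proofs below: a nonnegative slack `e`, followed by an equation that
  -- the ring solver can usually check.
  _by_ : ∀ {x y e} → 0# ≤ e → x + e ≈ y → x ≤ y
  _by_ {x} {y} {e} 0≤e eq = begin
    x       ≈⟨ +-identityʳ x ⟨
    x + 0#  ≤⟨ +-mono-≤ ≤-refl 0≤e ⟩
    x + e   ≈⟨ eq ⟩
    y       ∎

  0≤-⇒≤ : ∀ {x y} → 0# ≤ y - x → x ≤ y
  0≤-⇒≤ {x} {y} 0≤y-x = 0≤y-x by solve 2 (λ x y → x :+ (y :- x) := y) refl x y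

  ≤0⇒0≤- : ∀ {x} → x ≤ 0# → 0# ≤ - x
  ≤0⇒0≤- {x} x≤0 = ≤-respʳ-≈ (+-identityˡ (- x)) (≤⇒0≤- x≤0)

  *-monoˡ-≤ : ∀ {x y z} → 0# ≤ z → x ≤ y → z * x ≤ z * y
  *-monoˡ-≤ {x} {y} {z} 0≤z x≤y = *-nonNeg 0≤z (≤⇒0≤- x≤y)
    by solve 3 (λ x y z → z :* x :+ z :* (y :- x) := z :* y) refl x y z

  ²-nonNeg : ∀ x → 0# ≤ x ²
  ²-nonNeg x with ≤-total 0# x
  ... | inj₁ 0≤x = *-nonNeg 0≤x 0≤x
  ... | inj₂ x≤0 = ≤-respʳ-≈ (solve 1 (λ x → :- x :* :- x := x :* x) refl x)
                     (*-nonNeg (≤0⇒0≤- x≤0) (≤0⇒0≤- x≤0))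

  0≤1 : 0# ≤ 1#
  0≤1 = ≤-respʳ-≈ (*-identityʳ 1#) (²-nonNeg 1#)

  0<1 : 0# < 1#
  0<1 1≤0 = 0≉1 (antisym 0≤1 1≤0)

  1≤⇒0< : ∀ {x} → 1# ≤ x → 0# < x
  1≤⇒0< = <-≤-trans 0<1

  *-cancelˡ-≈0 : ∀ {x y} → ¬ (x ≈ 0#) → x * y ≈ 0# → y ≈ 0#
  *-cancelˡ-≈0 {x} {y} x≉0 xy≈0 = begin-equality
    y               ≈⟨ *-identityˡ y ⟨
    1# * y          ≈⟨ *-congʳ (⁻¹-inverseʳ x x≉0) ⟨
    x * x ⁻¹ * y    ≈⟨ solve 3 (λ x i y → x :* i :* y := i :* (x :* y)) refl x (x ⁻¹) y ⟩
    x ⁻¹ * (x * y)  ≈⟨ *-congˡ xy≈0 ⟩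
    x ⁻¹ * 0#       ≈⟨ zeroʳ _ ⟩
    0#              ∎

  *-cancelˡ-0≤ : ∀ {x y} → 0# < x → 0# ≤ x * y → 0# ≤ y
  *-cancelˡ-0≤ {x} {y} 0<x 0≤xy with ≤-total 0# y
  ... | inj₁ 0≤y = 0≤y
  ... | inj₂ y≤0 = ≤-reflexive (sym (*-cancelˡ-≈0 (<⇒≉0 0<x) (antisym xy≤0 0≤xy)))
    where
    xy≤0 : x * y ≤ 0#
    xy≤0 = ≤-respʳ-≈ (zeroʳ x) (*-monoˡ-≤ (<⇒≤ 0<x) y≤0)

  *-cancelˡ-≤ : ∀ {x y z} → 0# < z → z * x ≤ z * y → x ≤ y
  *-cancelˡ-≤ {x} {y} {z} 0<z zx≤zy = 0≤-⇒≤ (*-cancelˡ-0≤ 0<z (≤-respʳ-≈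
    (solve 3 (λ x y z → z :* y :- z :* x := z :* (y :- x)) refl x y z) (≤⇒0≤- zx≤zy)))

  *-pos : ∀ {x y} → 0# < x → 0# < y → 0# < x * y
  *-pos {x} {y} 0<x 0<y xy≤0 = 0<y (*-cancelˡ-≤ 0<x (≤-respʳ-≈ (sym (zeroʳ x)) xy≤0))

  ⁻¹-pos : ∀ {x} → 0# < x → 0# < x ⁻¹
  ⁻¹-pos {x} 0<x x⁻¹≤0 = 0<1 (begin
    1#        ≈⟨ ⁻¹-inverseʳ x (<⇒≉0 0<x) ⟨
    x * x ⁻¹  ≤⟨ *-monoˡ-≤ (<⇒≤ 0<x) x⁻¹≤0 ⟩
    x * 0#    ≈⟨ zeroʳ x ⟩
    0#        ∎)

  -- Otherwise `x + y` is positive and can be cancelled from (x + y) x ≤ (x + y) y, which is x² ≤ y²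
  -- with y x added on both sides.
  ²-cancel-≤ : ∀ {x y} → 0# ≤ y → x ² ≤ y ² → x ≤ y
  ²-cancel-≤ {x} {y} 0≤y x²≤y² with x ≤? y
  ... | yes x≤y = x≤y
  ... | no  y<x = contradiction
      (*-cancelˡ-≤ 0<x+y (≤-trans
        (≤-reflexive (solve 2 (λ x y → (x :+ y) :* x := x :* x :+ y :* x) refl x y))
        (≤-trans (+-monoˡ-≤ (y * x) x²≤y²)
        (≤-reflexive (solve 2 (λ x y → y :* y :+ y :* x := (x :+ y) :* y) refl x y)))))
      y<x
    where
    0<x+y : 0# < x + y
    0<x+y = <-≤-trans (≤-<-trans 0≤y y<x) (0≤y by refl)

  ²≤0⇒≈0 : ∀ {x} → x ² ≤ 0# → x ≈ 0#
  ²≤0⇒≈0 {x} x²≤0 with x ≟ 0#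
  ... | yes x≈0 = x≈0
  ... | no  x≉0 = *-cancelˡ-≈0 x≉0 (antisym x²≤0 (²-nonNeg x))

  -- The root is the supremum of the `r ≥ 0` with `r ² ≤ x`. This set contains 0 and is bounded by
  -- `1# + x`, because x ≤ (1 + x)².
  sqrt : ∀ x → 0# ≤ x → ∃[ s ] IsSqrt x s
  sqrt x 0≤x = s , 0≤s , antisym s²≤x x≤s²
    where
    P : Carrier → Set
    P r = 0# ≤ r × r ² ≤ x

    bound : ∀ r → P r → r ≤ 1# + x
    bound r (0≤r , r²≤x) = ²-cancel-≤ (+-nonNeg 0≤1 0≤x) (≤-trans r²≤x
      (+-nonNeg 0≤1 (+-nonNeg 0≤x (²-nonNeg x))
        by solve 1 (λ x → x :+ (𝟙 :+ (x :+ x :* x)) := (𝟙 :+ x) :* (𝟙 :+ x)) refl x))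

    least-upper-bound = supremum P
      (0# , ≤-refl , ≤-respˡ-≈ (sym (zeroˡ 0#)) 0≤x) (1# + x , bound)

    s = proj₁ least-upper-bound
    P≤s = proj₁ (proj₂ least-upper-bound)
    s≤ = proj₂ (proj₂ least-upper-bound)

    0≤s : 0# ≤ s
    0≤s = P≤s 0# (≤-refl , ≤-respˡ-≈ (sym (zeroˡ 0#)) 0≤x)

    -- Otherwise s + ε lies in P, where ε (2 s + 1 + gap) = gap.
    x≤s² : x ≤ s ²
    x≤s² = ≤-stable λ s²<x →
      let gap = x - s ²
          0<gap = λ gap≤0 → s²<x (0≤-⇒≤ (≤-respʳ-≈
                    (solve 2 (λ x s → :- (x :- s :* s) := s :* s :- x) refl x s) (≤0⇒0≤- gap≤0)))
          q = (s + s + 1#) + gap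
          0<q = 1≤⇒0< (+-nonNeg (+-nonNeg 0≤s 0≤s) (<⇒≤ 0<gap)
                  by solve 2 (λ s g → 𝟙 :+ ((s :+ s) :+ g) := ((s :+ s) :+ 𝟙) :+ g) refl s gap)
          ε = gap * q ⁻¹
          0<ε = *-pos 0<gap (⁻¹-pos 0<q)
          εq≈gap : ε * q ≈ gap
          εq≈gap = begin-equality
            gap * q ⁻¹ * q    ≈⟨ solve 3 (λ g i q → g :* i :* q := g :* (q :* i)) refl gap (q ⁻¹) q ⟩
            gap * (q * q ⁻¹)  ≈⟨ *-congˡ (⁻¹-inverseʳ q (<⇒≉0 0<q)) ⟩
            gap * 1#          ≈⟨ *-identityʳ gap ⟩
            gap               ∎
          0≤ε = <⇒≤ 0<ε
          -- gap − (2 s ε + ε²) = ε (1 + gap − ε), and ε ≤ 1 as gap ≤ q.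
          0≤1-ε : 0# ≤ 1# - ε
          0≤1-ε = *-cancelˡ-0≤ 0<q (≤-respʳ-≈
            (begin-equality
              s + s + 1#        ≈⟨ solve 2 (λ a g → a := (a :+ g) :- g) refl (s + s + 1#) gap ⟩
              q - gap           ≈⟨ +-congˡ (-‿cong εq≈gap) ⟨
              q - ε * q         ≈⟨ solve 2 (λ q e → q :- e :* q := q :* (𝟙 :- e)) refl q ε ⟩
              q * (1# - ε)      ∎)
            (+-nonNeg (+-nonNeg 0≤s 0≤s) 0≤1))
          s+ε∈P : P (s + ε)
          s+ε∈P = +-nonNeg 0≤s 0≤ε , (*-nonNeg 0≤ε (+-nonNeg 0≤1-ε (<⇒≤ 0<gap)) by (begin-equality
            (s + ε) ² + ε * (1# - ε + gap)
              ≈⟨ solve 3 (λ s e g → (s :+ e) :* (s :+ e) :+ e :* (𝟙 :- e :+ g) := s :* s :+ e :* ((s :+ s :+ 𝟙) :+ g)) refl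
                   s ε gap ⟩
            s ² + ε * q       ≈⟨ +-congˡ εq≈gap ⟩
            s ² + gap         ≈⟨ solve 2 (λ t x → t :+ (x :- t) := x) refl (s ²) x ⟩
            x                 ∎))
      in 0<ε (≤-respˡ-≈ (solve 2 (λ s e → (s :+ e) :- s := e) refl s ε)
           (≤-respʳ-≈ (-‿inverseʳ s) (+-monoˡ-≤ (- s) (P≤s (s + ε) s+ε∈P))))

    -- Otherwise the Newton step s′ = (s + x / s) / 2 is an upper bound of P below s.
    s²≤x : s ² ≤ x
    s²≤x = ≤-stable λ x<s² →
      let 0<s² = ≤-<-trans 0≤x x<s²
          0<s = ≤∧≉0⇒< 0≤s (λ s≈0 → 0<s² (≤-reflexive (trans (*-congʳ s≈0) (zeroˡ s))))
          2s = s + s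
          0<2s = <-≤-trans 0<s (0≤s by refl)
          i = 2s ⁻¹
          2si≈1 = ⁻¹-inverseʳ 2s (<⇒≉0 0<2s)
          s′ = (s ² + x) * i
          2ss′ : 2s * s′ ≈ s ² + x
          2ss′ = trans (solve 3 (λ t i y → t :* (y :* i) := t :* i :* y) refl 2s i (s ² + x))
                       (trans (*-congʳ 2si≈1) (*-identityˡ _))
          bound′ : ∀ r → P r → r ≤ s′
          -- The inequality 2 s r ≤ s² + r² comes from (s - r)² ≥ 0.
          bound′ r (_ , r²≤x) = *-cancelˡ-≤ 0<2s (begin
            2s * r
              ≤⟨ ²-nonNeg (s - r) by solve 2 (λ s r → (s :+ s) :* r :+ (s :- r) :* (s :- r) := s :* s :+ r :* r) refl
                   s r ⟩
            s ² + r ²    ≤⟨ +-mono-≤ ≤-refl r²≤x ⟩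
            s ² + x      ≈⟨ 2ss′ ⟨
            2s * s′      ∎)
      -- Leastness of `s` gives s ≤ s′, hence 2 s² ≤ 2 s s′ = s² + x.
      in x<s² (begin
           s ²                 ≈⟨ solve 1 (λ s → s :* s := (s :+ s) :* s :- s :* s) refl s ⟩
           2s * s - s ²        ≤⟨ +-monoˡ-≤ _ (*-monoˡ-≤ (<⇒≤ 0<2s) (s≤ s′ bound′)) ⟩
           2s * s′ - s ²       ≈⟨ +-congʳ 2ss′ ⟩
           (s ² + x) - s ²     ≈⟨ solve 2 (λ t x → (t :+ x) :- t := x) refl (s ²) x ⟩
           x                   ∎)

-- Finite sums and the Cauchy-Schwarz inequality.

module Sums (ℝ : Reals) where
  open OrderedField ℝ public
  open SemiringSum semiring public
    using (sum; sum-syntax; sum-cong-≋; ∑-distrib-+; ∑-comm; *-distribˡ-sum; *-distribʳ-sum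
          ; sum-remove; sum-replicate-zero)
  open Spectral ℝ public
  open ≤-Reasoning

  private
    variable
      n : ℕ

  sum-mono : {f g : Fin n → Carrier} → (∀ i → f i ≤ g i) → sum f ≤ sum g
  sum-mono {zero}  f≤g = ≤-refl
  sum-mono {suc n} f≤g = +-mono-≤ (f≤g zero) (sum-mono (f≤g ∘ suc))

  sum-nonNeg : {f : Fin n → Carrier} → (∀ i → 0# ≤ f i) → 0# ≤ sum f
  sum-nonNeg {n} 0≤f = ≤-respˡ-≈ (sum-replicate-zero n) (sum-mono 0≤f)

  term≤sum : {f : Fin n → Carrier} → (∀ i → 0# ≤ f i) → ∀ i → f i ≤ sum f
  term≤sum {suc n} {f} 0≤f i = sum-nonNeg (0≤f ∘ punchIn i) by sym (sum-remove f)

  sum-const : ∀ x → sum {n} (λ _ → x) ≈ fromℕ n * x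
  sum-const {zero}  x = sym (zeroˡ x)
  sum-const {suc n} x = begin-equality
    x + sum {n} (λ _ → x)  ≈⟨ +-congˡ (sum-const {n} x) ⟩
    x + fromℕ n * x        ≈⟨ solve 2 (λ x k → x :+ k :* x := (𝟙 :+ k) :* x) refl x (fromℕ n) ⟩
    (1# + fromℕ n) * x     ∎

  sum-linear : ∀ a b (f g : Fin n → Carrier) →
    ∑[ i < n ] (a * f i + b * g i) ≈ a * sum f + b * sum g
  sum-linear a b f g = trans (∑-distrib-+ (λ i → a * f i) (λ i → b * g i))
    (+-cong (sym (*-distribˡ-sum a f)) (sym (*-distribˡ-sum b g)))

  sum-identity : ∀ (i : Fin n) (f : Fin n → Carrier) → ∑[ j < n ] (identity i j * f j) ≈ f i
  sum-identity {suc n} zero f = trans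
    (+-cong (*-identityˡ _) (trans (sum-cong-≋ (λ j → zeroˡ (f (suc j)))) (sum-replicate-zero n)))
    (+-identityʳ _)
  sum-identity {suc n} (suc i) f = trans
    (+-cong (zeroˡ _) (sum-identity i (f ∘ suc))) (+-identityˡ _)

  ∑∑ : Matrix Carrier n → Carrier
  ∑∑ {n} M = ∑[ i < n ] ∑[ j < n ] M i j

  ∑∑-cong : {M M′ : Matrix Carrier n} → (∀ i j → M i j ≈ M′ i j) → ∑∑ M ≈ ∑∑ M′
  ∑∑-cong M≈M′ = sum-cong-≋ λ i → sum-cong-≋ (M≈M′ i)

  ∑∑-+ : ∀ (M M′ : Matrix Carrier n) → ∑∑ (λ i j → M i j + M′ i j) ≈ ∑∑ M + ∑∑ M′
  ∑∑-+ M M′ = trans (sum-cong-≋ λ i → ∑-distrib-+ (M i) (M′ i))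
    (∑-distrib-+ (λ i → sum (M i)) (λ i → sum (M′ i)))

  *-distribˡ-∑∑ : ∀ x (M : Matrix Carrier n) → x * ∑∑ M ≈ ∑∑ (λ i j → x * M i j)
  *-distribˡ-∑∑ x M = trans (*-distribˡ-sum x (λ i → sum (M i)))
    (sum-cong-≋ λ i → *-distribˡ-sum x (M i))

  -- Additivity of this relation is what proves Cauchy–Schwarz for all finite sums.
  IsCauchySchwarz : Carrier → Carrier → Carrier → Set
  IsCauchySchwarz A B C = 0# ≤ A × 0# ≤ B × C ² ≤ A * B

  cs-* : ∀ a b → IsCauchySchwarz (a ²) (b ²) (a * b)
  cs-* a b = ²-nonNeg a , ²-nonNeg b ,
    ≤-reflexive (solve 2 (λ a b → (a :* b) :* (a :* b) := (a :* a) :* (b :* b)) refl a b)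

  -- After expansion only 2 C C′ ≤ A B′ + A′ B remains (`cross`). Its left side has square 4 C² C′²
  -- ≤ 4 (A B′) (A′ B), which is at most (A B′ + A′ B)² since (A B′ - A′ B)² ≥ 0.
  cs-+ : ∀ {A B C A′ B′ C′} → IsCauchySchwarz A B C → IsCauchySchwarz A′ B′ C′ →
         IsCauchySchwarz (A + A′) (B + B′) (C + C′)
  cs-+ {A} {B} {C} {A′} {B′} {C′} (0≤A , 0≤B , C²≤AB) (0≤A′ , 0≤B′ , C′²≤A′B′) =
    +-nonNeg 0≤A 0≤A′ , +-nonNeg 0≤B 0≤B′ , (begin
      (C + C′) ²
        ≈⟨ solve 2 (λ c d → (c :+ d) :* (c :+ d) := c :* c :+ d :* d :+ (c :* d :+ c :* d)) refl C C′ ⟩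
      C ² + C′ ² + (C * C′ + C * C′)
        ≤⟨ +-mono-≤ (+-mono-≤ C²≤AB C′²≤A′B′) cross ⟩
      A * B + A′ * B′ + (A * B′ + A′ * B)
        ≈⟨ solve 4 (λ a b c d → a :* b :+ c :* d :+ (a :* d :+ c :* b) := (a :+ c) :* (b :+ d)) refl
             A B A′ B′ ⟩
      (A + A′) * (B + B′)  ∎)
    where
    CC′²≤ABA′B′ : C ² * C′ ² ≤ (A * B) * (A′ * B′)
    CC′²≤ABA′B′ = ≤-trans (*-monoˡ-≤ (²-nonNeg C) C′²≤A′B′)
      (≤-trans (≤-reflexive (*-comm _ _))
      (≤-trans (*-monoˡ-≤ (*-nonNeg 0≤A′ 0≤B′) C²≤AB) (≤-reflexive (*-comm _ _))))

    cross : C * C′ + C * C′ ≤ A * B′ + A′ * B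
    cross = ²-cancel-≤ (+-nonNeg (*-nonNeg 0≤A 0≤B′) (*-nonNeg 0≤A′ 0≤B)) (begin
      (C * C′ + C * C′) ²
        ≈⟨ solve 2 (λ c d → (c :* d :+ c :* d) :* (c :* d :+ c :* d) := four :* ((c :* c) :* (d :* d))) refl
             C C′ ⟩
      fromℕ 4 * (C ² * C′ ²)
        ≤⟨ *-monoˡ-≤ 0≤4 CC′²≤ABA′B′ ⟩
      fromℕ 4 * ((A * B) * (A′ * B′))
        ≤⟨ ²-nonNeg (A * B′ - A′ * B) by solve 4 (λ a b c d →
             four :* ((a :* b) :* (c :* d)) :+ (a :* d :- c :* b) :* (a :* d :- c :* b)
             := (a :* d :+ c :* b) :* (a :* d :+ c :* b)) refl A B A′ B′ ⟩
      (A * B′ + A′ * B) ²  ∎)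
      where
      0≤4 : 0# ≤ fromℕ 4
      0≤4 = +-nonNeg 0≤1 (+-nonNeg 0≤1 (+-nonNeg 0≤1 (+-nonNeg 0≤1 ≤-refl)))

  cs-sum : {f g h : Fin n → Carrier} → (∀ i → IsCauchySchwarz (f i) (g i) (h i)) →
           IsCauchySchwarz (sum f) (sum g) (sum h)
  cs-sum {zero}  cs = ≤-refl , ≤-refl , ≤-refl
  cs-sum {suc n} cs = cs-+ (cs zero) (cs-sum (cs ∘ suc))

  -- Linear systems.

  NonZeroVector : (Fin n → Carrier) → Set
  NonZeroVector x = ∃[ i ] ¬ (x i ≈ 0#)

  sum-*-insertAt : ∀ (r : Fin (suc n) → Carrier) p v (x : Fin n → Carrier) →
    ∑[ j < suc n ] (r j * insertAt x p v j) ≈ r p * v + ∑[ j < n ] (r (punchIn p j) * x j)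
  sum-*-insertAt r p v x = trans (sum-remove {i = p} (λ j → r j * insertAt x p v j))
    (+-cong (*-congˡ (reflexive (insertAt-lookup x p v)))
            (sum-cong-≋ λ j → *-congˡ (reflexive (insertAt-punchIn x p v j))))

  nonZero-insertAt : ∀ {x : Fin n → Carrier} p v → NonZeroVector x → NonZeroVector (insertAt x p v)
  nonZero-insertAt {x = x} p v (i , xᵢ≉0) =
    punchIn p i , λ eq → xᵢ≉0 (trans (reflexive (≡.sym (insertAt-punchIn x p v i))) eq)

  -- Gaussian elimination by induction on the number of rows. If the first row vanishes, the unknown
  -- of column zero is set to 0 and the other rows are solved in the remaining unknowns; otherwise
  -- the first row eliminates the unknown of a pivot column `p`.
  underdetermined : (M : Fin n → Fin (suc n) → Carrier) →
    ∃[ x ] NonZeroVector x × (∀ r → ∑[ j < suc n ] (M r j * x j) ≈ 0#)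
  underdetermined {zero}  M = (λ _ → 1#) , (zero , λ 1≈0 → 0≉1 (sym 1≈0)) , λ ()
  underdetermined {suc n} M with Fin.any? (λ j → ¬? (M zero j ≟ 0#))
  ... | no  M₀≈0 =
    let (x , x≉0 , Mx≈0) = underdetermined (λ r j → M (suc r) (suc j))
    in insertAt x zero 0# , nonZero-insertAt zero 0# x≉0 , λ where
         zero    → trans (sum-cong-≋ λ j → trans
                     (*-congʳ (decidable-stable (M zero j ≟ 0#) (λ M₀ⱼ≉0 → M₀≈0 (j , M₀ⱼ≉0)))) (zeroˡ (insertAt x zero 0# j)))
                     (sum-replicate-zero (suc (suc n)))
         (suc r) → trans (+-cong (zeroʳ _) (Mx≈0 r)) (+-identityʳ 0#)
  ... | yes (p , a≉0) =
    let a  = M zero p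
        -- Row `suc r` minus M (suc r) p / a times the pivot row, with column `p` left out, where it
        -- vanishes. The factor `1#` gives the form that `sum-linear` expects.
        M′ = λ r j → 1# * M (suc r) (punchIn p j) + (- (M (suc r) p * a ⁻¹)) * M zero (punchIn p j)
        (x , x≉0 , M′x≈0) = underdetermined M′
        S  = λ r → ∑[ j < suc n ] (M r (punchIn p j) * x j)
        -- Back-substitution: the value of unknown `p` that the pivot row forces.
        v  = - (a ⁻¹ * S zero)
    in insertAt x p v , nonZero-insertAt p v x≉0 , λ where
         zero    → begin-equality
           ∑[ j < suc (suc n) ] (M zero j * insertAt x p v j)
             ≈⟨ sum-*-insertAt (M zero) p v x ⟩
           a * - (a ⁻¹ * S zero) + S zero
             ≈⟨ solve 3 (λ a i s → a :* (:- (i :* s)) :+ s := s :- (a :* i) :* s) refl a (a ⁻¹) (S zero) ⟩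
           S zero - (a * a ⁻¹) * S zero
             ≈⟨ +-congˡ (-‿cong (*-congʳ (⁻¹-inverseʳ a a≉0))) ⟩
           S zero - 1# * S zero
             ≈⟨ solve 1 (λ s → s :- 𝟙 :* s := 𝟘) refl (S zero) ⟩
           0#  ∎
         (suc r) → begin-equality
           ∑[ j < suc (suc n) ] (M (suc r) j * insertAt x p v j)
             ≈⟨ sum-*-insertAt (M (suc r)) p v x ⟩
           M (suc r) p * - (a ⁻¹ * S zero) + S (suc r)
             ≈⟨ solve 4 (λ m i s t → m :* (:- (i :* s)) :+ t := 𝟙 :* t :+ (:- (m :* i)) :* s) refl
                  (M (suc r) p) (a ⁻¹) (S zero) (S (suc r)) ⟩
           1# * S (suc r) + (- (M (suc r) p * a ⁻¹)) * S zero
             ≈⟨ sum-linear 1# (- (M (suc r) p * a ⁻¹)) (λ j → M (suc r) (punchIn p j) * x j) (λ j → M zero (punchIn p j) * x j) ⟨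
           ∑[ j < suc n ] (1# * (M (suc r) (punchIn p j) * x j)
                           + (- (M (suc r) p * a ⁻¹)) * (M zero (punchIn p j) * x j))
             ≈⟨ sum-cong-≋ (λ j → solve 4 (λ m c k x → 𝟙 :* (m :* x) :+ c :* (k :* x) := (𝟙 :* m :+ c :* k) :* x) refl
                  (M (suc r) (punchIn p j)) (- (M (suc r) p * a ⁻¹)) (M zero (punchIn p j)) (x j)) ⟩
           ∑[ j < suc n ] (M′ r j * x j)
             ≈⟨ M′x≈0 r ⟩
           0#  ∎

  -- The augmented matrix (−b | M) has a nonzero null vector (c , x): either
  -- c vanishes and x is a null vector of M, or x / c solves the system.
  nullVector-or-solution : (M : Matrix Carrier n) (b : Fin n → Carrier) →
    (∃[ x ] NonZeroVector x × (∀ i → ∑[ j < n ] (M i j * x j) ≈ 0#)) ⊎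
    (∃[ y ] ∀ i → ∑[ j < n ] (M i j * y j) ≈ b i)
  nullVector-or-solution {n} M b with underdetermined (λ i → (- b i) ∷ M i)
  ... | x , x≉0 , Mx≈0 with x zero ≟ 0# | x≉0
  ...   | yes c≈0 | zero  , c≉0  = contradiction c≈0 c≉0
  ...   | yes c≈0 | suc i , xᵢ≉0 = inj₁ (x ∘ suc , (i , xᵢ≉0) , λ i → trans
          (sym (trans (+-congʳ (trans (*-congˡ c≈0) (zeroʳ _))) (+-identityˡ _))) (Mx≈0 i))
  ...   | no  c≉0 | _ = inj₂ ((λ j → x (suc j) * c ⁻¹) , λ i → begin-equality
          ∑[ j < n ] (M i j * (x (suc j) * c ⁻¹))
            ≈⟨ sum-cong-≋ (λ j → *-assoc (M i j) (x (suc j)) (c ⁻¹)) ⟨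
          ∑[ j < n ] (M i j * x (suc j) * c ⁻¹)
            ≈⟨ *-distribʳ-sum (c ⁻¹) (λ j → M i j * x (suc j)) ⟨
          S i * c ⁻¹
            ≈⟨ solve 4 (λ s b c d → s :* d := (:- b :* c :+ s) :* d :+ b :* (c :* d)) refl
                 (S i) (b i) c (c ⁻¹) ⟩
          (- b i * c + S i) * c ⁻¹ + b i * (c * c ⁻¹)
            ≈⟨ +-cong (trans (*-congʳ (Mx≈0 i)) (zeroˡ _)) (*-congˡ (⁻¹-inverseʳ c c≉0)) ⟩
          0# + b i * 1#
            ≈⟨ trans (+-identityˡ _) (*-identityʳ _) ⟩
          b i  ∎)
          where
          c : Carrier
          c = x zero

          S : Fin n → Carrier
          S i = ∑[ j < n ] (M i j * x (suc j))

-- Supersolutions and the spectral radius of nonnegative matrices.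

module Perron (ℝ : Reals) where
  open Sums ℝ public
  open ≤-Reasoning

  private
    variable
      n : ℕ

  NonNegative : Matrix Carrier n → Set
  NonNegative A = ∀ i j → 0# ≤ A i j

  infixr 8 _*ᵛ_

  _*ᵛ_ : Matrix Carrier n → (Fin n → Carrier) → Fin n → Carrier
  (A *ᵛ x) i = sum λ j → A i j * x j

  -- `t` is admissible when such a `v` exists; strict positivity allows division by the entries of
  -- `v`.
  IsSuperSolution : Matrix Carrier n → Carrier → (Fin n → Carrier) → Set
  IsSuperSolution A t v = (∀ i → 0# < v i) × (∀ i → (A *ᵛ v) i ≤ t * v i)

  argmin : (f : Fin (suc n) → Carrier) → ∃[ k ] ∀ i → f k ≤ f i
  argmin {zero}  f = zero , λ where zero → ≤-refl
  argmin {suc n} f with argmin (f ∘ suc)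
  ... | k , fₖ≤ with ≤-total (f zero) (f (suc k))
  ...   | inj₁ f₀≤fₖ = zero  , λ where
          zero    → ≤-refl
          (suc i) → ≤-trans f₀≤fₖ (fₖ≤ i)
  ...   | inj₂ fₖ≤f₀ = suc k , λ where
          zero    → fₖ≤f₀
          (suc i) → fₖ≤ i

  ⁻¹-inverseˡ : ∀ {x} → 0# < x → x ⁻¹ * x ≈ 1#
  ⁻¹-inverseˡ {x} 0<x = trans (*-comm _ _) (⁻¹-inverseʳ x (<⇒≉0 0<x))

  -- Evaluate at an index k minimising w k / v k.
  comparison : ∀ {A : Matrix Carrier n} {s t v w} → NonNegative A → IsSuperSolution A s v → s < t →
    (∀ i → (A *ᵛ w) i ≤ t * w i) → ∀ i → 0# ≤ w i
  comparison {suc n} {A} {s} {t} {v} {w} 0≤A (0<v , Av≤sv) s<t Aw≤tw i = begin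
    0#           ≤⟨ *-nonNeg (<⇒≤ (0<v i)) 0≤m ⟩
    v i * m      ≤⟨ m-least i ⟩
    w i          ∎
    where
    k : Fin (suc n)
    k = proj₁ (argmin λ i → v i ⁻¹ * w i)

    m : Carrier
    m = v k ⁻¹ * w k

    v*v⁻¹*w≈w : ∀ i → v i * (v i ⁻¹ * w i) ≈ w i
    v*v⁻¹*w≈w i = trans (sym (*-assoc _ _ _)) (trans (*-congʳ (⁻¹-inverseʳ _ (<⇒≉0 (0<v i)))) (*-identityˡ _))

    m-least : ∀ i → v i * m ≤ w i
    m-least i = ≤-respʳ-≈ (v*v⁻¹*w≈w i)
      (*-monoˡ-≤ (<⇒≤ (0<v i)) (proj₂ (argmin λ i → v i ⁻¹ * w i) i))

    Avm≤Aw : (A *ᵛ v) k * m ≤ (A *ᵛ w) k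
    Avm≤Aw = begin
      (A *ᵛ v) k * m                        ≈⟨ *-distribʳ-sum m (λ j → A k j * v j) ⟩
      ∑[ j < suc n ] (A k j * v j * m)      ≈⟨ sum-cong-≋ (λ j → *-assoc (A k j) (v j) m) ⟩
      ∑[ j < suc n ] (A k j * (v j * m))    ≤⟨ sum-mono (λ j → *-monoˡ-≤ (0≤A k j) (m-least j)) ⟩
      (A *ᵛ w) k                            ∎

    0≤m : 0# ≤ m
    0≤m with ≤-total 0# m
    ... | inj₁ 0≤m = 0≤m
    -- For m ≤ 0 the chain s vₖ m ≤ (A v)ₖ m ≤ (A w)ₖ ≤ t wₖ = t vₖ m yields 0 ≤ (t - s) vₖ m, and
    -- the positive factor (t - s) vₖ is cancelled.
    ... | inj₂ m≤0 = *-cancelˡ-0≤ (*-pos (λ t-s≤0 → s<t (0≤-⇒≤ (≤-respʳ-≈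
            (solve 2 (λ s t → :- (t :- s) := s :- t) refl s t) (≤0⇒0≤- t-s≤0)))) (0<v k))
          (≤-respʳ-≈ (solve 4 (λ s t v m → t :* (v :* m) :- s :* v :* m := (t :- s) :* v :* m) refl
               s t (v k) m)
            (≤⇒0≤- (begin
              s * v k * m          ≤⟨ *-nonNeg (≤0⇒0≤- m≤0) (≤⇒0≤- (Av≤sv k)) by
                 solve 4 (λ s v m a → s :* v :* m :+ (:- m) :* (s :* v :- a) := a :* m) refl
                      s (v k) m ((A *ᵛ v) k) ⟩
              (A *ᵛ v) k * m       ≤⟨ Avm≤Aw ⟩
              (A *ᵛ w) k           ≤⟨ Aw≤tw k ⟩
              t * w k              ≈⟨ *-congˡ (v*v⁻¹*w≈w k) ⟨
              t * (v k * m)        ∎)))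

  -- Each row sum is at most the sum of all entries. This supplies one admissible number, without
  -- which no infimum could be taken.
  totalSum-superSolution : {A : Matrix Carrier n} → NonNegative A →
    IsSuperSolution A (∑∑ A) (λ _ → 1#)
  totalSum-superSolution {n} {A} 0≤A = (λ _ → 0<1) , λ i → begin
    (A *ᵛ (λ _ → 1#)) i              ≈⟨ sum-cong-≋ (λ j → *-identityʳ (A i j)) ⟩
    ∑[ j < n ] A i j                 ≤⟨ term≤sum (λ i → sum-nonNeg (0≤A i)) i ⟩
    ∑∑ A      ≈⟨ *-identityʳ _ ⟨
    (∑∑ A) * 1#  ∎

  halve : ∀ {x y} → x + x ≤ y + y → x ≤ y
  halve {x} {y} 2x≤2y = *-cancelˡ-≤ {z = 1# + 1#} (1≤⇒0< (0≤1 by refl)) (begin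
    (1# + 1#) * x   ≈⟨ solve 1 (λ x → (𝟙 :+ 𝟙) :* x := x :+ x) refl x ⟩
    x + x           ≤⟨ 2x≤2y ⟩
    y + y           ≈⟨ solve 1 (λ y → (𝟙 :+ 𝟙) :* y := y :+ y) refl y ⟨
    (1# + 1#) * y   ∎)

  -- 2 ≤ v j / v i + v i / v j for all i and j.
  symmetric-bound : ∀ {A S : Matrix Carrier n} {t v} → NonNegative S → (∀ i j → S i j ≈ S j i) →
    (∀ i j → S i j ≤ A i j) → IsSuperSolution A t v → ∑∑ S ≤ fromℕ n * t
  symmetric-bound {n} {A} {S} {t} {v} 0≤S S-sym S≤A (0<v , Av≤tv) = halve (begin
    ∑∑ S + ∑∑ S                            ≈⟨ ∑∑-+ S S ⟨
    ∑∑ (λ i j → S i j + S i j)             ≤⟨ sum-mono (λ i → sum-mono (λ j → 2S≤ i j)) ⟩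
    ∑∑ (λ i j → X i j + X j i)             ≈⟨ ∑∑-+ X (λ i j → X j i) ⟩
    ∑∑ X + ∑∑ (λ i j → X j i)              ≈⟨ +-congˡ (∑-comm X) ⟨
    ∑∑ X + ∑∑ X                            ≤⟨ +-mono-≤ ∑∑X≤nt ∑∑X≤nt ⟩
    fromℕ n * t + fromℕ n * t              ∎)
    where
    z : Fin n → Carrier
    z i = v i ⁻¹

    zv≈1 : ∀ i → z i * v i ≈ 1#
    zv≈1 i = ⁻¹-inverseˡ (0<v i)

    X : Matrix Carrier n
    X i j = z i * (S i j * v j)

    2S≤ : ∀ i j → S i j + S i j ≤ X i j + X j i
    -- The slack is Sᵢⱼ (vᵢ - vⱼ)² / (vᵢ vⱼ) = Sᵢⱼ (vⱼ / vᵢ + vᵢ / vⱼ - 2).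
    2S≤ i j = *-nonNeg (*-nonNeg (0≤S i j) (*-nonNeg (<⇒≤ (⁻¹-pos (0<v i))) (<⇒≤ (⁻¹-pos (0<v j))))) (²-nonNeg (v i - v j))
      by (begin-equality
        S i j + S i j + S i j * (z i * z j) * (v i - v j) ²
          ≈⟨ solve 5 (λ s x y v w → s :+ s :+ s :* (x :* y) :* ((v :- w) :* (v :- w)) :=
               s :+ s :+ s :* ((x :* v) :* (y :* v) :+ (y :* w) :* (x :* w) :- ((x :* v) :* (y :* w) :+ (x :* v) :* (y :* w)))) refl
               (S i j) (z i) (z j) (v i) (v j) ⟩
        S i j + S i j + S i j * ((z i * v i) * (z j * v i) + (z j * v j) * (z i * v j) - ((z i * v i) * (z j * v j) + (z i * v i) * (z j * v j)))
          ≈⟨ +-congˡ (*-congˡ (+-cong (+-cong (*-congʳ (zv≈1 i)) (*-congʳ (zv≈1 j)))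
               (-‿cong (+-cong (*-cong (zv≈1 i) (zv≈1 j)) (*-cong (zv≈1 i) (zv≈1 j)))))) ⟩
        S i j + S i j + S i j * (1# * (z j * v i) + 1# * (z i * v j) - (1# * 1# + 1# * 1#))
          ≈⟨ solve 5 (λ s x y v w → s :+ s :+ s :* (𝟙 :* (y :* v) :+ 𝟙 :* (x :* w) :- (𝟙 :* 𝟙 :+ 𝟙 :* 𝟙))
               := x :* (s :* w) :+ y :* (s :* v)) refl (S i j) (z i) (z j) (v i) (v j) ⟩
        X i j + z j * (S i j * v i)
          ≈⟨ +-congˡ (*-congˡ (*-congʳ (S-sym i j))) ⟩
        X i j + X j i  ∎)

    ∑∑X≤nt : ∑∑ X ≤ fromℕ n * t
    -- Row i of `X` sums to (S v)ᵢ / vᵢ ≤ (A v)ᵢ / vᵢ ≤ t.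
    ∑∑X≤nt = begin
      ∑∑ X                           ≤⟨ sum-mono (λ i → begin
        sum (X i)                      ≈⟨ *-distribˡ-sum (z i) (λ j → S i j * v j) ⟨
        z i * (S *ᵛ v) i               ≤⟨ *-monoˡ-≤ (<⇒≤ (⁻¹-pos (0<v i))) (sum-mono (λ j → begin
          S i j * v j                    ≈⟨ *-comm _ _ ⟩
          v j * S i j                    ≤⟨ *-monoˡ-≤ (<⇒≤ (0<v j)) (S≤A i j) ⟩
          v j * A i j                    ≈⟨ *-comm _ _ ⟩
          A i j * v j                    ∎)) ⟩
        z i * (A *ᵛ v) i               ≤⟨ *-monoˡ-≤ (<⇒≤ (⁻¹-pos (0<v i))) (Av≤tv i) ⟩
        z i * (t * v i)
          ≈⟨ solve 3 (λ z t v → z :* (t :* v) := (z :* v) :* t) refl (z i) t (v i) ⟩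
        z i * v i * t                  ≈⟨ *-congʳ (zv≈1 i) ⟩
        1# * t                         ≈⟨ *-identityˡ t ⟩
        t                              ∎) ⟩
      sum {n} (λ _ → t)              ≈⟨ sum-const {n} t ⟩
      fromℕ n * t                    ∎

  -- Real matrices over the complex numbers.

  complexify : Matrix Carrier n → Matrix ℂ n
  complexify A i j = fromReal (A i j)

  re-sumᶜ : (f : Fin n → ℂ) → re (sumᶜ f) ≡ sum (re ∘ f)
  re-sumᶜ {zero}  f = ≡.refl
  re-sumᶜ {suc n} f = ≡.cong (re (f zero) +_) (re-sumᶜ (f ∘ suc))

  im-sumᶜ : (f : Fin n → ℂ) → im (sumᶜ f) ≡ sum (im ∘ f)
  im-sumᶜ {zero}  f = ≡.refl
  im-sumᶜ {suc n} f = ≡.cong (im (f zero) +_) (im-sumᶜ (f ∘ suc))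

  re-complexify-*ᵛ : ∀ (A : Matrix Carrier n) x i →
    re (sumᶜ (λ j → complexify A i j *ᶜ x j)) ≈ (A *ᵛ (re ∘ x)) i
  re-complexify-*ᵛ A x i = trans (reflexive (re-sumᶜ (λ j → complexify A i j *ᶜ x j))) (sum-cong-≋ λ j →
    solve 3 (λ a p q → a :* p :- 𝟘 :* q := a :* p) refl (A i j) (re (x j)) (im (x j)))

  im-complexify-*ᵛ : ∀ (A : Matrix Carrier n) x i →
    im (sumᶜ (λ j → complexify A i j *ᶜ x j)) ≈ (A *ᵛ (im ∘ x)) i
  im-complexify-*ᵛ A x i = trans (reflexive (im-sumᶜ (λ j → complexify A i j *ᶜ x j))) (sum-cong-≋ λ j →
    solve 3 (λ a p q → a :* q :+ 𝟘 :* p := a :* q) refl (A i j) (re (x j)) (im (x j)))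

  realEigenvalue : ∀ {A : Matrix Carrier n} {t x} → NonZeroVector x → (∀ i → (A *ᵛ x) i ≈ t * x i) →
    IsEigenvalue (complexify A) (fromReal t)
  realEigenvalue {n} {A} {t} {x} (k , xₖ≉0) Ax≈tx = (fromReal ∘ x) , (k , xₖ≉0 ∘ proj₁) , λ i →
    trans (re-complexify-*ᵛ A (fromReal ∘ x) i) (trans (Ax≈tx i)
      (solve 2 (λ t x → t :* x := t :* x :- 𝟘 :* 𝟘) refl t (x i))) ,
    trans (im-complexify-*ᵛ A (fromReal ∘ x) i) (trans (sum-cong-≋ (λ j → zeroʳ (A i j)))
      (trans (sum-replicate-zero n) (solve 2 (λ t x → 𝟘 := t :* 𝟘 :+ 𝟘 :* x) refl t (x i))))

  isModulus-fromReal : ∀ {t} → 0# ≤ t → IsModulus (fromReal t) t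
  isModulus-fromReal {t} 0≤t = 0≤t , solve 1 (λ t → t :* t := t :* t :+ 𝟘 :* 𝟘) refl t

  shifted : Carrier → Matrix Carrier n → Matrix Carrier n
  shifted t A i j = t * identity i j - A i j

  shifted-*ᵛ : ∀ t (A : Matrix Carrier n) x i → (shifted t A *ᵛ x) i ≈ t * x i - (A *ᵛ x) i
  shifted-*ᵛ t A x i = begin-equality
    (shifted t A *ᵛ x) i
      ≈⟨ sum-cong-≋ (λ j → solve 4 (λ t e a x → (t :* e :- a) :* x := t :* (e :* x) :+ (:- 𝟙) :* (a :* x)) refl
           t (identity i j) (A i j) (x j)) ⟩
    sum (λ j → t * (identity i j * x j) + - 1# * (A i j * x j))
      ≈⟨ sum-linear t (- 1#) (λ j → identity i j * x j) (λ j → A i j * x j) ⟩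
    t * sum (λ j → identity i j * x j) + - 1# * (A *ᵛ x) i
      ≈⟨ +-cong (*-congˡ (sum-identity i x)) (solve 1 (λ a → (:- 𝟙) :* a := :- a) refl ((A *ᵛ x) i)) ⟩
    t * x i - (A *ᵛ x) i  ∎

  -- With t₀ the infimum of the t admitting a supersolution, t₀ - ε would admit one
  -- if t₀ were not an eigenvalue, namely the solution y of t₀ y - A y = 1.
  superSolutions-bound-spectralRadius : ∀ {A : Matrix Carrier n} {μ ρ} → NonNegative A →
    (∀ {t v} → IsSuperSolution A t v → μ ≤ t) → IsSpectralRadius (complexify A) ρ → μ ≤ ρ
  superSolutions-bound-spectralRadius {n} {A} {μ} {ρ} 0≤A μ≤ ((_ , _ , 0≤ρ , _) , ≤ρ) =
    ≤-stable contradictory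
    where
    IsLowerBound : Carrier → Set
    IsLowerBound x = ∀ {t v} → IsSuperSolution A t v → x ≤ t

    -- The infimum of the admissible numbers, obtained as the supremum of their lower bounds: `μ` is
    -- such a bound, and the admissible sum of all entries lies above all of them.
    infimum = supremum IsLowerBound (μ , μ≤)
      (_ , λ x x≤ → x≤ (totalSum-superSolution 0≤A))

    t₀ : Carrier
    t₀ = proj₁ infimum

    t₀≤ : IsLowerBound t₀
    t₀≤ {t} sup = proj₂ (proj₂ infimum) t (λ x x≤ → x≤ sup)

    contradictory : ¬ ¬ (μ ≤ ρ)
    contradictory ρ<μ with nullVector-or-solution (shifted t₀ A) (λ _ → 1#)
    -- A null vector of t₀ I - A makes t₀ an eigenvalue, and it is its own modulus as t₀ ≥ 0. Hence
    -- t₀ ≤ ρ < μ ≤ t₀.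
    ... | inj₁ (x , x≉0 , Mx≈0) = <-≤-trans ρ<μ (proj₁ (proj₂ infimum) μ μ≤)
          (≤ρ (fromReal t₀) t₀ (realEigenvalue {A = A} {t₀} {x} x≉0 λ i →
            sym (x∙y⁻¹≈ε⇒x≈y _ _ (trans (sym (shifted-*ᵛ t₀ A x i)) (Mx≈0 i))))
            (isModulus-fromReal (≤-trans 0≤ρ (<⇒≤ (<-≤-trans ρ<μ (proj₁ (proj₂ infimum) μ μ≤))))))
    -- Since A y = t₀ y - 1 and ε y ≤ 1, the positive vector `y` satisfies A y ≤ (t₀ - ε) y. So t₀ ≤
    -- t₀ - ε, which is absurd.
    ... | inj₂ (y , My≈1) = 0<ε (begin
          ε               ≈⟨ solve 2 (λ t e → e := t :- (t :- e)) refl t₀ ε ⟩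
          t₀ - (t₀ - ε)   ≤⟨ +-monoˡ-≤ _ (t₀≤ (0<y , λ i → 0≤1-εy i by
                               trans (solve 4 (λ a e y t → a :+ (𝟙 :- e :* y) := (a :+ 𝟙) :- e :* y) refl
                                    ((A *ᵛ y) i) ε (y i) t₀)
                               (trans (+-congʳ (Ay+1≈t₀y i))
                               (solve 3 (λ t y e → t :* y :- e :* y := (t :- e) :* y) refl t₀ (y i) ε)))) ⟩
          (t₀ - ε) - (t₀ - ε) ≈⟨ -‿inverseʳ _ ⟩
          0#              ∎)
      where
      0<t₀ : 0# < t₀
      0<t₀ = ≤-<-trans 0≤ρ (<-≤-trans ρ<μ (proj₁ (proj₂ infimum) μ μ≤))

      Ay+1≈t₀y : ∀ i → (A *ᵛ y) i + 1# ≈ t₀ * y i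
      Ay+1≈t₀y i = trans (+-congˡ (trans (sym (My≈1 i)) (shifted-*ᵛ t₀ A y i)))
        (solve 2 (λ a t → a :+ (t :- a) := t) refl ((A *ᵛ y) i) (t₀ * y i))

      -- Chosen so that ε |yᵢ| ≤ 1 for every i, because |yᵢ| ≤ 1 + yᵢ² ≤ K.
      K ε : Carrier
      K = 1# + ∑[ i < n ] (y i ²)
      ε = K ⁻¹

      0<K : 0# < K
      0<K = 1≤⇒0< (sum-nonNeg (λ i → ²-nonNeg (y i)) by refl)

      0<ε : 0# < ε
      0<ε = ⁻¹-pos 0<K

      ≤1+² : ∀ x → x ≤ 1# + x ²
      ≤1+² x with ≤-total 0# x
      ... | inj₁ 0≤x = +-nonNeg 0≤x (²-nonNeg (1# - x))
            by solve 1 (λ x → x :+ (x :+ (𝟙 :- x) :* (𝟙 :- x)) := 𝟙 :+ x :* x) refl x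
      ... | inj₂ x≤0 = ≤-trans x≤0 (+-nonNeg 0≤1 (²-nonNeg x))

      -- Stated through squares so that it covers both `y i` and `- y i`.
      εx≤1 : ∀ {x} → (∃[ i ] x ² ≈ y i ²) → ε * x ≤ 1#
      εx≤1 {x} (i , x²≈yᵢ²) = begin
        ε * x              ≤⟨ *-monoˡ-≤ (<⇒≤ 0<ε) (≤1+² x) ⟩
        ε * (1# + x ²)     ≈⟨ *-congˡ (+-congˡ x²≈yᵢ²) ⟩
        ε * (1# + y i ²)   ≤⟨ *-monoˡ-≤ (<⇒≤ 0<ε) (+-mono-≤ ≤-refl (term≤sum (λ i → ²-nonNeg (y i)) i)) ⟩
        ε * K              ≈⟨ ⁻¹-inverseˡ 0<K ⟩
        1#                 ∎

      0≤1-εy : ∀ i → 0# ≤ 1# - ε * y i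
      0≤1-εy i = ≤⇒0≤- (εx≤1 (i , refl))

      0≤1+εy : ∀ i → 0# ≤ 1# + ε * y i
      0≤1+εy i = ≤-respʳ-≈ (solve 2 (λ e y → 𝟙 :- e :* (:- y) := 𝟙 :+ e :* y) refl ε (y i))
        (≤⇒0≤- (εx≤1 (i , solve 1 (λ y → (:- y) :* (:- y) := y :* y) refl (y i))))

      t₀+ε≰ : ¬ (t₀ + ε ≤ t₀)
      t₀+ε≰ t₀+ε≤t₀ = 0<ε (begin
        ε                ≈⟨ solve 2 (λ t e → e := (t :+ e) :- t) refl t₀ ε ⟩
        (t₀ + ε) - t₀    ≤⟨ +-monoˡ-≤ _ t₀+ε≤t₀ ⟩
        t₀ - t₀          ≈⟨ -‿inverseʳ _ ⟩
        0#               ∎)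

      0≤y : ∀ i → 0# ≤ y i
      -- From 1 + ε y ≥ 0 follows A y = t₀ y - 1 ≤ (t₀ + ε) y. An admissible t < t₀ + ε would thus
      -- give y ≥ 0 by `comparison`. If yᵢ < 0, there is no such t, and t₀ + ε is a lower bound
      -- exceeding the greatest one.
      0≤y i = ≤-stable λ yᵢ<0 → t₀+ε≰ (proj₁ (proj₂ infimum) (t₀ + ε) λ v-sup → ≤-stable λ t<t₀+ε →
        yᵢ<0 (comparison 0≤A v-sup t<t₀+ε (λ j → 0≤1+εy j by
          trans (solve 3 (λ a e y → a :+ (𝟙 :+ e :* y) := (a :+ 𝟙) :+ e :* y) refl ((A *ᵛ y) j) ε (y j))
          (trans (+-congʳ (Ay+1≈t₀y j)) (sym (distribʳ (y j) t₀ ε)))) i))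

      0<y : ∀ i → 0# < y i
      -- As A y ≥ 0, already t₀ yᵢ = (A y)ᵢ + 1 ≥ 1.
      0<y i yᵢ≤0 = 0<1 (begin
        1#
          ≤⟨ sum-nonNeg (λ j → *-nonNeg (0≤A i j) (0≤y j)) by trans (+-comm _ _) (Ay+1≈t₀y i) ⟩
        t₀ * y i            ≤⟨ *-monoˡ-≤ (<⇒≤ 0<t₀) yᵢ≤0 ⟩
        t₀ * 0#             ≈⟨ zeroʳ t₀ ⟩
        0#                  ∎)

-- Vectors of moduli, Frobenius products and arc counts.

module DigraphSpectra (ℝ : Reals) where
  open Perron ℝ public
  open ≤-Reasoning
  open SemiringMult semiring using (×-homo-+)

  private
    variable
      n : ℕ

  trace : Matrix Carrier n → Carrier
  trace M = sum λ i → M i i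

  -- The entries of `y` are the moduli of those of the eigenvector. The triangle inequality gives ρ
  -- y ≤ A y; pairing with `y` gives the claim.
  moduli-of-eigenvector : ∀ {A : Matrix Carrier n} {z ρ} → NonNegative A →
    IsEigenvalue (complexify A) z → IsModulus z ρ →
    ∃[ y ] (0# < ∑[ i < n ] (y i ²)) × (ρ * ∑[ i < n ] (y i ²) ≤ ∑∑ (λ i j → A i j * (y i * y j)))
  moduli-of-eigenvector {n} {A} {z} {ρ} 0≤A (x , (k , xₖ≉0) , Ax≈zx) (0≤ρ , ρ²≈∣z∣²) = y , 0<∑y² , (begin
    ρ * ∑[ i < n ] (y i ²)                   ≈⟨ *-distribˡ-sum ρ (λ i → y i ²) ⟩
    ∑[ i < n ] (ρ * y i ²)                   ≤⟨ sum-mono (λ i → begin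
      ρ * y i ²
        ≈⟨ solve 2 (λ r y → r :* (y :* y) := y :* (r :* y)) refl ρ (y i) ⟩
      y i * (ρ * y i)                          ≤⟨ *-monoˡ-≤ (0≤y i) (ρy≤Ay i) ⟩
      y i * (A *ᵛ y) i                         ≈⟨ *-distribˡ-sum (y i) (λ j → A i j * y j) ⟩
      sum (λ j → y i * (A i j * y j))
        ≈⟨ sum-cong-≋ (λ j → solve 3 (λ u a v → u :* (a :* v) := a :* (u :* v)) refl (y i) (A i j) (y j)) ⟩
      sum (λ j → A i j * (y i * y j))          ∎) ⟩
    ∑∑ (λ i j → A i j * (y i * y j))         ∎)
    where
    ∣x∣² : Fin n → Carrier
    ∣x∣² i = re (x i) ² + im (x i) ²

    modulus : ∀ i → ∃[ r ] IsSqrt (∣x∣² i) r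
    modulus i = sqrt _ (+-nonNeg (²-nonNeg (re (x i))) (²-nonNeg (im (x i))))

    y : Fin n → Carrier
    y i = proj₁ (modulus i)

    0≤y : ∀ i → 0# ≤ y i
    0≤y i = proj₁ (proj₂ (modulus i))

    y²≈ : ∀ i → y i ² ≈ ∣x∣² i
    y²≈ i = proj₂ (proj₂ (modulus i))

    0<∑y² : 0# < ∑[ i < n ] (y i ²)
    0<∑y² ∑y²≤0 = xₖ≉0 (²≤0⇒≈0 (≤-trans (²-nonNeg (im (x k)) by refl) ∣xₖ∣²≤0) ,
                       ²≤0⇒≈0 (≤-trans (²-nonNeg (re (x k)) by +-comm _ _) ∣xₖ∣²≤0))
      where
      ∣xₖ∣²≤0 : ∣x∣² k ≤ 0#
      ∣xₖ∣²≤0 = ≤-trans (≤-reflexive (sym (y²≈ k))) (≤-trans (term≤sum (λ i → ²-nonNeg (y i)) k) ∑y²≤0)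

    ρy≤Ay : ∀ i → ρ * y i ≤ (A *ᵛ y) i
    ρy≤Ay i with ρ * y i ≟ 0#
    ... | yes ρy≈0 = ≤-respˡ-≈ (sym ρy≈0) (sum-nonNeg (λ j → *-nonNeg (0≤A i j) (0≤y j)))
    -- Division by ρ yᵢ > 0. With a + b i the number z xᵢ = (A x)ᵢ, the square (ρ yᵢ)² = a² + b² is
    -- the sum over j of Aᵢⱼ (a Re xⱼ + b Im xⱼ), and Cauchy-Schwarz in the plane bounds each
    -- bracket by ρ yᵢ yⱼ.
    ... | no  ρy≉0 = *-cancelˡ-≤ (≤∧≉0⇒< 0≤ρy ρy≉0) (begin
        (ρ * y i) ²
          ≈⟨ ρy²≈ ⟩
        a ² + b ²
          ≈⟨ +-cong (*-congˡ (trans (sym (proj₁ (Ax≈zx i))) (re-complexify-*ᵛ A x i)))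
                    (*-congˡ (trans (sym (proj₂ (Ax≈zx i))) (im-complexify-*ᵛ A x i))) ⟩
        a * (A *ᵛ (re ∘ x)) i + b * (A *ᵛ (im ∘ x)) i
          ≈⟨ sum-linear a b (λ j → A i j * re (x j)) (λ j → A i j * im (x j)) ⟨
        sum (λ j → a * (A i j * re (x j)) + b * (A i j * im (x j)))
          ≤⟨ sum-mono (λ j → begin
            a * (A i j * re (x j)) + b * (A i j * im (x j))
              ≈⟨ solve 5 (λ a b m p q → a :* (m :* p) :+ b :* (m :* q) := m :* (a :* p :+ b :* q)) refl
                   a b (A i j) (re (x j)) (im (x j)) ⟩
            A i j * (a * re (x j) + b * im (x j))
              ≤⟨ *-monoˡ-≤ (0≤A i j) (inner≤ j) ⟩
            A i j * (ρ * y i * y j)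
              ≈⟨ solve 3 (λ m r y → m :* (r :* y) := r :* (m :* y)) refl (A i j) (ρ * y i) (y j) ⟩
            ρ * y i * (A i j * y j)  ∎) ⟩
        sum (λ j → ρ * y i * (A i j * y j))
          ≈⟨ *-distribˡ-sum (ρ * y i) (λ j → A i j * y j) ⟨
        ρ * y i * (A *ᵛ y) i  ∎)
      where
      0≤ρy : 0# ≤ ρ * y i
      0≤ρy = *-nonNeg 0≤ρ (0≤y i)

      a b : Carrier
      a = re (z *ᶜ x i)
      b = im (z *ᶜ x i)

      ρy²≈ : (ρ * y i) ² ≈ a ² + b ²
      ρy²≈ = begin-equality
        (ρ * y i) ²
          ≈⟨ solve 2 (λ r y → (r :* y) :* (r :* y) := (r :* r) :* (y :* y)) refl ρ (y i) ⟩
        ρ ² * y i ²                          ≈⟨ *-cong ρ²≈∣z∣² (y²≈ i) ⟩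
        (re z ² + im z ²) * ∣x∣² i
          ≈⟨ solve 4 (λ p q u v → (p :* p :+ q :* q) :* (u :* u :+ v :* v) :=
                                                   (p :* u :- q :* v) :* (p :* u :- q :* v) :+ (p :* v :+ q :* u) :* (p :* v :+ q :* u)) refl
                                                   (re z) (im z) (re (x i)) (im (x i)) ⟩
        a ² + b ²                            ∎

      inner≤ : ∀ j → a * re (x j) + b * im (x j) ≤ ρ * y i * y j
      inner≤ j = ²-cancel-≤ (*-nonNeg 0≤ρy (0≤y j)) (begin
        (a * re (x j) + b * im (x j)) ²
          ≤⟨ proj₂ (proj₂ (cs-+ (cs-* a (re (x j))) (cs-* b (im (x j))))) ⟩
        (a ² + b ²) * ∣x∣² j
          ≈⟨ *-cong ρy²≈ (y²≈ j) ⟨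
        (ρ * y i) ² * y j ²
          ≈⟨ solve 2 (λ r y → (r :* r) :* (y :* y) := (r :* y) :* (r :* y)) refl (ρ * y i) (y j) ⟩
        (ρ * y i * y j) ²  ∎)

  identity-diagonal : ∀ (i : Fin n) → identity i i ≈ 1#
  identity-diagonal i with i Fin.≟ i
  ... | yes _   = refl
  ... | no  i≢i = contradiction ≡.refl i≢i

  -- The Frobenius product of X - x I and Y - y I, expanded with ⟨X , I⟩ = trace X and ⟨I , I⟩ = n.
  -- The norms and the product in the Cauchy-Schwarz step for the upper bound are instances.
  ∑∑-shift-* : ∀ (X Y : Matrix Carrier n) x y →
    ∑∑ (λ i j → (X i j - x * identity i j) * (Y i j - y * identity i j)) ≈
    ∑∑ (λ i j → X i j * Y i j) + (- y * trace X + - x * trace Y + fromℕ n * (x * y))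
  ∑∑-shift-* {n} X Y x y = begin-equality
    ∑∑ (λ i j → (X i j - x * identity i j) * (Y i j - y * identity i j))
      ≈⟨ sum-cong-≋ row ⟩
    ∑[ i < n ] (sum (λ j → X i j * Y i j) + (diagonal i + x * y))
      ≈⟨ ∑-distrib-+ (λ i → sum (λ j → X i j * Y i j)) (λ i → diagonal i + x * y) ⟩
    ∑∑ (λ i j → X i j * Y i j) + ∑[ i < n ] (diagonal i + x * y)
      ≈⟨ +-congˡ (trans (∑-distrib-+ diagonal (λ _ → x * y))
           (+-cong (sum-linear (- y) (- x) (λ i → X i i) (λ i → Y i i)) (sum-const {n} (x * y)))) ⟩
    ∑∑ (λ i j → X i j * Y i j) + (- y * trace X + - x * trace Y + fromℕ n * (x * y))  ∎
    where
    diagonal : Fin n → Carrier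
    diagonal i = - y * X i i + - x * Y i i

    row : ∀ i → sum (λ j → (X i j - x * identity i j) * (Y i j - y * identity i j)) ≈
                sum (λ j → X i j * Y i j) + (diagonal i + x * y)
    row i = begin-equality
      sum (λ j → (X i j - x * identity i j) * (Y i j - y * identity i j))
        ≈⟨ sum-cong-≋ (λ j → solve 5 (λ X Y x y e → (X :- x :* e) :* (Y :- y :* e) :=
             X :* Y :+ e :* (((:- y) :* X :+ (:- x) :* Y) :+ x :* y :* e)) refl (X i j) (Y i j) x y (identity i j)) ⟩
      sum (λ j → X i j * Y i j + identity i j * (- y * X i j + - x * Y i j + x * y * identity i j))
        ≈⟨ ∑-distrib-+ (λ j → X i j * Y i j) (λ j → identity i j * (- y * X i j + - x * Y i j + x * y * identity i j)) ⟩
      sum (λ j → X i j * Y i j) + sum (λ j → identity i j * (- y * X i j + - x * Y i j + x * y * identity i j))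
        ≈⟨ +-congˡ (trans (sum-identity i (λ j → - y * X i j + - x * Y i j + x * y * identity i j))
             (+-congˡ (trans (*-congˡ (identity-diagonal i)) (*-identityʳ _)))) ⟩
      sum (λ j → X i j * Y i j) + (diagonal i + x * y)  ∎

  -- Loops, arcs and mutual arcs as sums of matrix entries.

  fromℕ-∣tabulate∣ : ∀ (f : Fin n → Bool) → fromℕ ∣ tabulate f ∣ ≈ ∑[ i < n ] (if f i then 1# else 0#)
  fromℕ-∣tabulate∣ {zero}  f = refl
  fromℕ-∣tabulate∣ {suc n} f with f zero
  ... | true  = +-congˡ (fromℕ-∣tabulate∣ (f ∘ suc))
  ... | false = trans (fromℕ-∣tabulate∣ (f ∘ suc)) (sym (+-identityˡ _))

  open RawMonoidDefinitions ℕ.+-0-rawMonoid using () renaming (sum to sumℕ)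

  fromℕ-sum : ∀ (f : Fin n → ℕ) → fromℕ (sumℕ f) ≈ ∑[ i < n ] fromℕ (f i)
  fromℕ-sum {zero}  f = refl
  fromℕ-sum {suc n} f = trans (×-homo-+ 1# (f zero) (sumℕ (f ∘ suc))) (+-congˡ (fromℕ-sum (f ∘ suc)))

  0≤adjacency : ∀ (D : Digraph n) → NonNegative (adjacency D)
  0≤adjacency D i j with arc D i j
  ... | true  = 0≤1
  ... | false = ≤-refl

  adjacency-idem : ∀ (D : Digraph n) i j → adjacency D i j ² ≈ adjacency D i j
  adjacency-idem D i j with arc D i j
  ... | true  = *-identityʳ 1#
  ... | false = zeroʳ 0#

  mutualArcs : Digraph n → Matrix Carrier n
  mutualArcs D i j = adjacency D i j * adjacency D j i

  mutualArcs≤adjacency : ∀ (D : Digraph n) i j → mutualArcs D i j ≤ adjacency D i j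
  mutualArcs≤adjacency D i j with arc D i j | arc D j i
  ... | true  | true  = ≤-reflexive (*-identityʳ 1#)
  ... | true  | false = ≤-trans (≤-reflexive (zeroʳ 1#)) 0≤1
  ... | false | _     = ≤-reflexive (zeroˡ _)

  σ≈trace : ∀ (D : Digraph n) → fromℕ (σ D) ≈ trace (adjacency D)
  σ≈trace D = fromℕ-∣tabulate∣ (λ v → arc D v v)

  -- The diagonal entries aᵢᵢ² = aᵢᵢ of `mutualArcs D` count the loops, the other entries count the
  -- pairs of `c₂`.
  c₂+σ≈∑∑-mutualArcs : ∀ (D : Digraph n) → fromℕ (c₂ D) + fromℕ (σ D) ≈ ∑∑ (mutualArcs D)
  c₂+σ≈∑∑-mutualArcs {n} D = begin-equality
    fromℕ (c₂ D) + fromℕ (σ D)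
      ≈⟨ +-cong (fromℕ-sum (λ v → ∣ mutualNeighbours D v ∣)) (σ≈trace D) ⟩
    ∑[ v < n ] fromℕ ∣ mutualNeighbours D v ∣ + ∑[ v < n ] adjacency D v v
      ≈⟨ ∑-distrib-+ (λ v → fromℕ ∣ mutualNeighbours D v ∣) (λ v → adjacency D v v) ⟨
    ∑[ v < n ] (fromℕ ∣ mutualNeighbours D v ∣ + adjacency D v v)
      ≈⟨ sum-cong-≋ (λ v → +-cong (fromℕ-∣tabulate∣ (λ w → not (does (v Fin.≟ w)) ∧ (arc D v w ∧ arc D w v)))
           (sym (sum-identity v (λ w → adjacency D v w)))) ⟩
    ∑[ v < n ] (sum (proper v) + ∑[ w < n ] (identity v w * adjacency D v w))
      ≈⟨ sum-cong-≋ (λ v → ∑-distrib-+ (proper v) (λ w → identity v w * adjacency D v w)) ⟨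
    ∑[ v < n ] ∑[ w < n ] (proper v w + identity v w * adjacency D v w)
      ≈⟨ ∑∑-cong split ⟩
    ∑∑ (mutualArcs D)  ∎
    where
    proper : Matrix Carrier n
    proper v w = if not (does (v Fin.≟ w)) ∧ (arc D v w ∧ arc D w v) then 1# else 0#

    split : ∀ v w → proper v w + identity v w * adjacency D v w ≈ mutualArcs D v w
    split v w with v Fin.≟ w
    ... | yes ≡.refl = trans (+-identityˡ _) (trans (*-identityˡ _) (sym (adjacency-idem D v v)))
    ... | no  _ with arc D v w | arc D w v
    ...   | true  | true  = solve 0 (𝟙 :+ 𝟘 :* 𝟙 := 𝟙 :* 𝟙) refl
    ...   | true  | false = solve 0 (𝟘 :+ 𝟘 :* 𝟙 := 𝟙 :* 𝟘) refl
    ...   | false | true  = solve 0 (𝟘 :+ 𝟘 :* 𝟘 := 𝟘 :* 𝟙) refl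
    ...   | false | false = solve 0 (𝟘 :+ 𝟘 :* 𝟘 := 𝟘 :* 𝟘) refl

  -- The second case keeps σ = 0 because the identity behind the radicand relies on it when δ = 1.
  δ-cases : ∀ (D : Digraph n) → fromℕ (δ D) ≈ 0# ⊎ (fromℕ (δ D) ≈ 1# × fromℕ (σ D) ≈ 0#)
  δ-cases D with σ D
  ... | zero  = inj₂ (+-identityʳ 1# , refl)
  ... | suc _ = inj₁ refl

  trace-complement : ∀ (D : Digraph n) →
    trace (adjacency D) + trace (adjacency (complement D)) ≈ fromℕ n - fromℕ (δ D) * fromℕ n
  trace-complement {n} D = begin-equality
    trace (adjacency D) + trace (adjacency (complement D))
      ≈⟨ ∑-distrib-+ (λ i → adjacency D i i) (λ i → adjacency (complement D) i i) ⟨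
    ∑[ i < n ] (adjacency D i i + adjacency (complement D) i i)
      ≈⟨ sum-cong-≋ (λ i → trans (+-congˡ (trans (adjacency-complement D i i)
             (+-congʳ (+-congˡ (-‿cong (*-congˡ (identity-diagonal i)))))))
           (solve 2 (λ a d → a :+ (𝟙 :- d :* 𝟙 :- a) := 𝟙 :- d) refl (adjacency D i i) (fromℕ (δ D)))) ⟩
    ∑[ i < n ] (1# - fromℕ (δ D))
      ≈⟨ sum-const {n} (1# - fromℕ (δ D)) ⟩
    fromℕ n * (1# - fromℕ (δ D))
      ≈⟨ solve 2 (λ n d → n :* (𝟙 :- d) := n :- d :* n) refl (fromℕ n) (fromℕ (δ D)) ⟩
    fromℕ n - fromℕ (δ D) * fromℕ n  ∎

  ∑∑-complement : ∀ (D : Digraph n) →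
    ∑∑ (adjacency D) + ∑∑ (adjacency (complement D)) ≈ fromℕ n ² - fromℕ (δ D) * fromℕ n
  ∑∑-complement {n} D = begin-equality
    ∑∑ (adjacency D) + ∑∑ (adjacency (complement D))
      ≈⟨ ∑-distrib-+ (λ i → sum (adjacency D i)) (λ i → sum (adjacency (complement D) i)) ⟨
    ∑[ i < n ] (sum (adjacency D i) + sum (adjacency (complement D) i))
      ≈⟨ sum-cong-≋ row ⟩
    ∑[ i < n ] (fromℕ n - fromℕ (δ D))
      ≈⟨ sum-const {n} (fromℕ n - fromℕ (δ D)) ⟩
    fromℕ n * (fromℕ n - fromℕ (δ D))
      ≈⟨ solve 2 (λ n d → n :* (n :- d) := n :* n :- d :* n) refl (fromℕ n) (fromℕ (δ D)) ⟩
    fromℕ n ² - fromℕ (δ D) * fromℕ n  ∎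
    where
    row : ∀ i → sum (adjacency D i) + sum (adjacency (complement D) i) ≈ fromℕ n - fromℕ (δ D)
    row i = begin-equality
      sum (adjacency D i) + sum (adjacency (complement D) i)
        ≈⟨ ∑-distrib-+ (adjacency D i) (adjacency (complement D) i) ⟨
      sum (λ j → adjacency D i j + adjacency (complement D) i j)
        ≈⟨ sum-cong-≋ (λ j → trans (+-congˡ (adjacency-complement D i j))
             (solve 3 (λ a d e → a :+ (𝟙 :- d :* e :- a) := 𝟙 :+ e :* (:- d)) refl
                  (adjacency D i j) (fromℕ (δ D)) (identity i j))) ⟩
      sum (λ j → 1# + identity i j * (- fromℕ (δ D)))
        ≈⟨ ∑-distrib-+ (λ _ → 1#) (λ j → identity i j * (- fromℕ (δ D))) ⟩
      sum {n} (λ _ → 1#) + sum (λ j → identity i j * (- fromℕ (δ D)))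
        ≈⟨ +-cong (trans (sum-const {n} 1#) (*-identityʳ _)) (sum-identity i (λ _ → - fromℕ (δ D))) ⟩
      fromℕ n - fromℕ (δ D)  ∎

-- Bounds for the spectral radius of one digraph.

module RadiusBounds (ℝ : Reals) where
  open DigraphSpectra ℝ public
  open ≤-Reasoning

  private
    variable
      n : ℕ

  fromℕ-pos : ∀ n → .{{NonZero n}} → 0# < fromℕ n
  fromℕ-pos (suc n) = 1≤⇒0< (0≤fromℕ n by refl)
    where
    0≤fromℕ : ∀ n → 0# ≤ fromℕ n
    0≤fromℕ zero    = ≤-refl
    0≤fromℕ (suc n) = +-nonNeg 0≤1 (0≤fromℕ n)

  -- `symmetric-bound` for `mutualArcs D`, which is symmetric and lies entrywise below the adjacency
  -- matrix, puts the left side below every admissible number.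
  spectralRadius-lower : .{{_ : NonZero n}} (D : Digraph n) {ρ : Carrier} →
    IsDigraphSpectralRadius D ρ → fromℕ n ⁻¹ * (fromℕ (c₂ D) + fromℕ (σ D)) ≤ ρ
  spectralRadius-lower {n} D {ρ} isρ = superSolutions-bound-spectralRadius (0≤adjacency D) (λ {t} {v} sup → begin
    N ⁻¹ * (fromℕ (c₂ D) + fromℕ (σ D))
      ≈⟨ *-congˡ (c₂+σ≈∑∑-mutualArcs D) ⟩
    N ⁻¹ * ∑∑ (mutualArcs D)
      ≤⟨ *-monoˡ-≤ (<⇒≤ (⁻¹-pos (fromℕ-pos n))) (symmetric-bound {t = t} {v}
           (λ i j → *-nonNeg (0≤adjacency D i j) (0≤adjacency D j i))
           (λ i j → *-comm _ _) (mutualArcs≤adjacency D) sup) ⟩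
    N ⁻¹ * (N * t)
      ≈⟨ trans (sym (*-assoc _ _ _)) (trans (*-congʳ (⁻¹-inverseˡ (fromℕ-pos n))) (*-identityˡ t)) ⟩
    t  ∎) isρ
    where
    N : Carrier
    N = fromℕ n

  -- Cauchy–Schwarz for (A + Aᵀ) - (2 σ / n) I and y yᵀ / |y|² - I / n.
  spectralRadius-upper : .{{_ : NonZero n}} (D : Digraph n) {ρ : Carrier} → IsDigraphSpectralRadius D ρ →
    let ν = fromℕ n ⁻¹
        s = fromℕ (σ D)
        T = ∑∑ (adjacency D)
        C = fromℕ (c₂ D) + s
    in ∃[ V ] (ρ ≤ V × IsCauchySchwarz
         ((T + T) + (C + C) - fromℕ 4 * (s ² * ν)) (1# - ν) ((V - s * ν) + (V - s * ν)))
  spectralRadius-upper {n} D {ρ} ((_ , eigen , modulus) , _) = V , ρ≤V , cs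
    where
    moduli = moduli-of-eigenvector (0≤adjacency D) eigen modulus

    y : Fin n → Carrier
    y = proj₁ moduli

    N ν s T C w V 2sν : Carrier
    N = fromℕ n
    ν = N ⁻¹
    s = fromℕ (σ D)
    T = ∑∑ (adjacency D)
    C = fromℕ (c₂ D) + s
    w = ∑[ i < n ] (y i ²)

    0<w = proj₁ (proj₂ moduli)
    ρw≤ = proj₂ (proj₂ moduli)

    a P H : Matrix Carrier n
    a = adjacency D
    P i j = w ⁻¹ * (y i * y j)
    H i j = a i j + a j i

    V = ∑∑ (λ i j → a i j * P i j)
    2sν = (s + s) * ν

    Nν≈1 : N * ν ≈ 1#
    Nν≈1 = ⁻¹-inverseʳ N (<⇒≉0 (fromℕ-pos n))

    ρ≤V : ρ ≤ V
    ρ≤V = *-cancelˡ-≤ 0<w (begin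
      w * ρ                                          ≈⟨ *-comm w ρ ⟩
      ρ * w                                          ≤⟨ ρw≤ ⟩
      ∑∑ (λ i j → a i j * (y i * y j))               ≈⟨ ∑∑-cong (λ i j → trans (sym (*-identityˡ _)) (trans
                                                          (*-congʳ (sym (⁻¹-inverseʳ w (<⇒≉0 0<w))))
                                                          (solve 4 (λ w i a y → w :* i :* (a :* y) := w :* (a :* (i :* y))) refl
                                                               w (w ⁻¹) (a i j) (y i * y j)))) ⟩
      ∑∑ (λ i j → w * (a i j * P i j))               ≈⟨ *-distribˡ-∑∑ w (λ i j → a i j * P i j) ⟨
      w * V                                          ∎)

    traceP : trace P ≈ 1#
    traceP = trans (sym (*-distribˡ-sum (w ⁻¹) (λ i → y i ²))) (⁻¹-inverseˡ 0<w)

    traceH : trace H ≈ s + s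
    traceH = trans (∑-distrib-+ (λ i → a i i) (λ i → a i i)) (sym (+-cong (σ≈trace D) (σ≈trace D)))

    -- `P` has rank one: Pᵢⱼ² = Pᵢᵢ Pⱼⱼ, so the sum is (trace P)².
    ∑∑PP : ∑∑ (λ i j → P i j * P i j) ≈ 1#
    ∑∑PP = begin-equality
      ∑∑ (λ i j → P i j * P i j)
        ≈⟨ ∑∑-cong (λ i j → solve 3 (λ v x y → v :* (x :* y) :* (v :* (x :* y)) := v :* (x :* x) :* (v :* (y :* y))) refl
             (w ⁻¹) (y i) (y j)) ⟩
      ∑∑ (λ i j → P i i * P j j)
        ≈⟨ sum-cong-≋ (λ i → trans (sym (*-distribˡ-sum (P i i) (λ j → P j j))) (trans (*-congˡ traceP) (*-identityʳ _))) ⟩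
      trace P
        ≈⟨ traceP ⟩
      1#  ∎

    -- `P` is symmetric, so A and its transpose have the same product with it.
    ∑∑HP : ∑∑ (λ i j → H i j * P i j) ≈ V + V
    ∑∑HP = begin-equality
      ∑∑ (λ i j → H i j * P i j)
        ≈⟨ ∑∑-cong (λ i j → solve 5 (λ a b v x y → (a :+ b) :* (v :* (x :* y)) := a :* (v :* (x :* y)) :+ b :* (v :* (y :* x))) refl
             (a i j) (a j i) (w ⁻¹) (y i) (y j)) ⟩
      ∑∑ (λ i j → a i j * P i j + a j i * P j i)
        ≈⟨ ∑∑-+ (λ i j → a i j * P i j) (λ i j → a j i * P j i) ⟩
      V + ∑∑ (λ i j → a j i * P j i)
        ≈⟨ +-congˡ (∑-comm (λ i j → a i j * P i j)) ⟨
      V + V  ∎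

    -- Entries are 0 or 1, so the squares add up to `T` for A and for Aᵀ; the mixed products are the
    -- mutual arcs.
    ∑∑HH : ∑∑ (λ i j → H i j * H i j) ≈ (T + T) + (C + C)
    ∑∑HH = begin-equality
      ∑∑ (λ i j → H i j * H i j)
        ≈⟨ ∑∑-cong (λ i j → trans
             (solve 2 (λ a b → (a :+ b) :* (a :+ b) := (a :* a :+ b :* b) :+ (a :* b :+ a :* b)) refl
                  (a i j) (a j i))
             (+-congʳ (+-cong (adjacency-idem D i j) (adjacency-idem D j i)))) ⟩
      ∑∑ (λ i j → (a i j + a j i) + (mutualArcs D i j + mutualArcs D i j))
        ≈⟨ ∑∑-+ (λ i j → a i j + a j i) (λ i j → mutualArcs D i j + mutualArcs D i j) ⟩
      ∑∑ (λ i j → a i j + a j i) + ∑∑ (λ i j → mutualArcs D i j + mutualArcs D i j)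
        ≈⟨ +-cong (trans (∑∑-+ a (λ i j → a j i)) (+-congˡ (sym (∑-comm a))))
                  (trans (∑∑-+ (mutualArcs D) (mutualArcs D)) (sym (+-cong (c₂+σ≈∑∑-mutualArcs D) (c₂+σ≈∑∑-mutualArcs D)))) ⟩
      (T + T) + (C + C)  ∎

    -- The multiples of the identity are trace H / n and trace P / n, which makes both matrices
    -- trace-free.
    B Q : Matrix Carrier n
    B i j = H i j - 2sν * identity i j
    Q i j = P i j - ν * identity i j

    ⟨B,B⟩ : ∑∑ (λ i j → B i j ²) ≈ (T + T) + (C + C) - fromℕ 4 * (s ² * ν)
    ⟨B,B⟩ = begin-equality
      ∑∑ (λ i j → B i j ²)
        ≈⟨ ∑∑-shift-* H H 2sν 2sν ⟩
      ∑∑ (λ i j → H i j * H i j) + (- 2sν * trace H + - 2sν * trace H + N * (2sν * 2sν))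
        ≈⟨ +-cong ∑∑HH (+-congʳ (+-cong (*-congˡ traceH) (*-congˡ traceH))) ⟩
      (T + T) + (C + C) + (- 2sν * (s + s) + - 2sν * (s + s) + N * (2sν * 2sν))
        ≈⟨ solve 4 (λ e s n v → let t = (s :+ s) :* v in
             e :+ ((:- t) :* (s :+ s) :+ (:- t) :* (s :+ s) :+ n :* (t :* t)) :=
             e :- four :* ((s :* s :* v) :+ (s :* s :* v) :- (n :* v) :* (s :* s :* v))) refl
             ((T + T) + (C + C)) s N ν ⟩
      (T + T) + (C + C) - fromℕ 4 * ((s ² * ν + s ² * ν) - (N * ν) * (s ² * ν))
        ≈⟨ +-congˡ (-‿cong (*-congˡ (trans (+-congˡ (-‿cong (trans (*-congʳ Nν≈1) (*-identityˡ _))))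
             (solve 1 (λ x → (x :+ x) :- x := x) refl (s ² * ν))))) ⟩
      (T + T) + (C + C) - fromℕ 4 * (s ² * ν)  ∎

    ⟨Q,Q⟩ : ∑∑ (λ i j → Q i j ²) ≈ 1# - ν
    ⟨Q,Q⟩ = begin-equality
      ∑∑ (λ i j → Q i j ²)
        ≈⟨ ∑∑-shift-* P P ν ν ⟩
      ∑∑ (λ i j → P i j * P i j) + (- ν * trace P + - ν * trace P + N * (ν * ν))
        ≈⟨ +-cong ∑∑PP (+-cong (+-cong (*-congˡ traceP) (*-congˡ traceP))
             (trans (sym (*-assoc _ _ _)) (*-congʳ Nν≈1))) ⟩
      1# + (- ν * 1# + - ν * 1# + 1# * ν)
        ≈⟨ solve 1 (λ v → 𝟙 :+ ((:- v) :* 𝟙 :+ (:- v) :* 𝟙 :+ 𝟙 :* v) := 𝟙 :- v) refl ν ⟩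
      1# - ν  ∎

    ⟨B,Q⟩ : ∑∑ (λ i j → B i j * Q i j) ≈ (V - s * ν) + (V - s * ν)
    ⟨B,Q⟩ = begin-equality
      ∑∑ (λ i j → B i j * Q i j)
        ≈⟨ ∑∑-shift-* H P 2sν ν ⟩
      ∑∑ (λ i j → H i j * P i j) + (- ν * trace H + - 2sν * trace P + N * (2sν * ν))
        ≈⟨ +-cong ∑∑HP (+-cong (+-cong (*-congˡ traceH) (*-congˡ traceP))
             (trans (solve 3 (λ n t v → n :* (t :* v) := (n :* v) :* t) refl N 2sν ν) (*-congʳ Nν≈1))) ⟩
      V + V + (- ν * (s + s) + - 2sν * 1# + 1# * 2sν)
        ≈⟨ solve 3 (λ V s v → let t = (s :+ s) :* v in
             V :+ V :+ ((:- v) :* (s :+ s) :+ (:- t) :* 𝟙 :+ 𝟙 :* t) := (V :- s :* v) :+ (V :- s :* v)) refl V s ν ⟩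
      (V - s * ν) + (V - s * ν)  ∎

    cs-cong : ∀ {A B C A′ B′ C′} → A ≈ A′ → B ≈ B′ → C ≈ C′ → IsCauchySchwarz A B C → IsCauchySchwarz A′ B′ C′
    cs-cong A≈ B≈ C≈ (0≤A , 0≤B , C²≤AB) = ≤-respʳ-≈ A≈ 0≤A , ≤-respʳ-≈ B≈ 0≤B ,
      ≤-respˡ-≈ (*-cong C≈ C≈) (≤-respʳ-≈ (*-cong A≈ B≈) C²≤AB)

    cs : IsCauchySchwarz ((T + T) + (C + C) - fromℕ 4 * (s ² * ν)) (1# - ν) ((V - s * ν) + (V - s * ν))
    cs = cs-cong ⟨B,B⟩ ⟨Q,Q⟩ ⟨B,Q⟩ (cs-sum λ i → cs-sum λ j → cs-* (B i j) (Q i j))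

  -- A digraph together with its complement.

  module _ (n : ℕ) .{{_ : NonZero n}} (D : Digraph n) where

    private
      N ν s s′ d c c′ T T′ : Carrier
      N  = fromℕ n
      ν  = N ⁻¹
      s  = fromℕ (σ D)
      s′ = fromℕ (σ (complement D))
      d  = fromℕ (δ D)
      c  = fromℕ (c₂ D)
      c′ = fromℕ (c₂ (complement D))
      T  = ∑∑ (adjacency D)
      T′ = ∑∑ (adjacency (complement D))

      Nν≈1 : N * ν ≈ 1#
      Nν≈1 = ⁻¹-inverseʳ N (<⇒≉0 (fromℕ-pos n))

      s+s′≈ : s + s′ ≈ N - d * N
      s+s′≈ = trans (+-cong (σ≈trace D) (σ≈trace (complement D))) (trace-complement D)

      [s+s′]ν≈1-d : (s + s′) * ν ≈ 1# - d
      [s+s′]ν≈1-d = begin-equality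
        (s + s′) * ν             ≈⟨ *-congʳ s+s′≈ ⟩
        (N - d * N) * ν
          ≈⟨ solve 3 (λ n v d → (n :- d :* n) :* v := n :* v :* (𝟙 :- d)) refl N ν d ⟩
        N * ν * (1# - d)         ≈⟨ trans (*-congʳ Nν≈1) (*-identityˡ _) ⟩
        1# - d                   ∎

    spectralRadii-sum-lower : ∀ {ρ ρ′} → IsDigraphSpectralRadius D ρ → IsDigraphSpectralRadius (complement D) ρ′ →
      (1# - d) + (c + c′) / N ≤ ρ + ρ′
    spectralRadii-sum-lower {ρ} {ρ′} isρ isρ′ = begin
      (1# - d) + (c + c′) * ν          ≈⟨ +-congʳ [s+s′]ν≈1-d ⟨
      (s + s′) * ν + (c + c′) * ν
        ≈⟨ solve 5 (λ s t c e v → (s :+ t) :* v :+ (c :+ e) :* v := v :* (c :+ s) :+ v :* (e :+ t)) refl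
             s s′ c c′ ν ⟩
      ν * (c + s) + ν * (c′ + s′)
        ≤⟨ +-mono-≤ (spectralRadius-lower D isρ) (spectralRadius-lower (complement D) isρ′) ⟩
      ρ + ρ′                           ∎

    private
      radicand : Carrier
      radicand = (((N - 1#) ² - (fromℕ 4 * s * (N - s)) / (N ²)) + (fromℕ 4 * s * (N - s)) / N)
                 + ((N - 1#) * (c + c′)) / N

      -- The squared Frobenius norms of the matrices `B` from `spectralRadius-upper`, added up for
      -- `D` and its complement.
      E : Carrier
      E = ((T + T) + ((c + s) + (c + s)) - fromℕ 4 * (s ² * ν))
          + ((T′ + T′) + ((c′ + s′) + (c′ + s′)) - fromℕ 4 * (s′ ² * ν))

      N²⁻¹≈ν² : (N ²) ⁻¹ ≈ ν ²
      N²⁻¹≈ν² = begin-equality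
        (N ²) ⁻¹                        ≈⟨ *-identityˡ _ ⟨
        1# * (N ²) ⁻¹                   ≈⟨ *-congʳ (trans (*-cong Nν≈1 Nν≈1) (*-identityˡ 1#)) ⟨
        N * ν * (N * ν) * (N ²) ⁻¹
          ≈⟨ solve 3 (λ n v i → n :* v :* (n :* v) :* i := (n :* n :* i) :* (v :* v)) refl N ν ((N ²) ⁻¹) ⟩
        N ² * (N ²) ⁻¹ * ν ²
          ≈⟨ *-congʳ (⁻¹-inverseʳ _ (<⇒≉0 (*-pos (fromℕ-pos n) (fromℕ-pos n)))) ⟩
        1# * ν ²                        ≈⟨ *-identityˡ _ ⟩
        ν ²                             ∎

      -- Allows a multiple of N ν - 1 to be added, so that the solver, which treats `N` and `ν` as
      -- independent, can prove identities that need N ν = 1.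
      z*≈0 : ∀ x → (N * ν - 1#) * x ≈ 0#
      z*≈0 x = trans (*-congʳ (trans (+-congʳ Nν≈1) (-‿inverseʳ 1#))) (zeroˡ x)

      s′≈ : s′ ≈ N - d * N - s
      s′≈ = trans (solve 2 (λ s t → t := s :+ t :- s) refl s s′) (+-congʳ s+s′≈)

      E≈ : E ≈ (N ² - d * N) + (N ² - d * N) + ((c + c′) + (N - d * N) + ((c + c′) + (N - d * N)))
               - fromℕ 4 * ((s ² + (N - d * N - s) ²) * ν)
      E≈ = begin-equality
        E
          ≈⟨ solve 7 (λ T U c e s t v →
               ((T :+ T) :+ ((c :+ s) :+ (c :+ s)) :- four :* (s :* s :* v)) :+
               ((U :+ U) :+ ((e :+ t) :+ (e :+ t)) :- four :* (t :* t :* v)) :=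
               (T :+ U) :+ (T :+ U) :+ ((c :+ e) :+ (s :+ t) :+ ((c :+ e) :+ (s :+ t)))
               :- four :* ((s :* s :+ t :* t) :* v)) refl T T′ c c′ s s′ ν ⟩
        (T + T′) + (T + T′) + ((c + c′) + (s + s′) + ((c + c′) + (s + s′))) - fromℕ 4 * ((s ² + s′ ²) * ν)
          ≈⟨ +-cong (+-cong (+-cong (∑∑-complement D) (∑∑-complement D))
               (+-cong (+-congˡ s+s′≈) (+-congˡ s+s′≈))) (-‿cong (*-congˡ (*-congʳ (+-congˡ (*-cong s′≈ s′≈))))) ⟩
        (N ² - d * N) + (N ² - d * N) + ((c + c′) + (N - d * N) + ((c + c′) + (N - d * N)))
          - fromℕ 4 * ((s ² + (N - d * N - s) ²) * ν)  ∎

      -- `F` and `R` are `E` and `radicand` as functions of `d` and `s`, so that the values from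
      -- `δ-cases` can be substituted; `E` is taken in the form of `E≈`, and `ν ²` replaces the
      -- inverse of `N ²`.
      F : Carrier → Carrier → Carrier
      F d s = (N ² - d * N) + (N ² - d * N) + ((c + c′) + (N - d * N) + ((c + c′) + (N - d * N)))
              - fromℕ 4 * ((s ² + (N - d * N - s) ²) * ν)

      R : Carrier → Carrier
      R s = (((N - 1#) ² - (fromℕ 4 * s * (N - s)) * ν ²) + (fromℕ 4 * s * (N - s)) * ν)
            + ((N - 1#) * (c + c′)) * ν

      F-cong : ∀ {d d′ s s′} → d ≈ d′ → s ≈ s′ → F d s ≈ F d′ s′
      F-cong {d} {d′} d≈ s≈ = +-cong (+-cong (+-cong N²-dN N²-dN) (+-cong (+-congˡ N-dN) (+-congˡ N-dN)))
        (-‿cong (*-congˡ (*-congʳ (+-cong (*-cong s≈ s≈) (*-cong N-dN-s N-dN-s)))))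
        where
        N²-dN = +-congˡ (-‿cong (*-congʳ d≈))
        N-dN : N - d * N ≈ N - d′ * N
        N-dN = +-congˡ (-‿cong (*-congʳ d≈))
        N-dN-s = +-cong N-dN (-‿cong s≈)

      R-cong : ∀ {s s′} → s ≈ s′ → R s ≈ R s′
      R-cong {s} {s′} s≈ = +-congʳ (+-cong (+-congˡ (-‿cong (*-congʳ q))) (*-congʳ q))
        where
        q : fromℕ 4 * s * (N - s) ≈ fromℕ 4 * s′ * (N - s′)
        q = *-cong (*-congˡ s≈) (+-congˡ (-‿cong s≈))

      -- Both sides agree modulo N ν = 1.
      F≈4R : ∀ {d s} → d ≈ 0# ⊎ (d ≈ 1# × s ≈ 0#) → F d s * ((1# - ν) + (1# - ν)) ≈ fromℕ 4 * R s
      F≈4R {d} {s} (inj₁ d≈0) = begin-equality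
        F d s * ((1# - ν) + (1# - ν))
          ≈⟨ *-congʳ (F-cong d≈0 refl) ⟩
        F 0# s * ((1# - ν) + (1# - ν))
          -- The cofactor of N ν - 1 is the polynomial quotient of 4 R - F (2 - 2 ν) by it.
          ≈⟨ trans (+-congˡ (z*≈0 _)) (+-identityʳ _) ⟨
        F 0# s * ((1# - ν) + (1# - ν)) + (N * ν - 1#) * (fromℕ 4 * ((c + c′) - (1# - N) + (N + N) * (1# - ν)))
          ≈⟨ solve 4 (λ n v s c →
               ((n :* n :- 𝟘 :* n) :+ (n :* n :- 𝟘 :* n) :+ (c :+ (n :- 𝟘 :* n) :+ (c :+ (n :- 𝟘 :* n)))
                 :- four :* ((s :* s :+ (n :- 𝟘 :* n :- s) :* (n :- 𝟘 :* n :- s)) :* v)) :* ((𝟙 :- v) :+ (𝟙 :- v))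
               :+ (n :* v :- 𝟙) :* (four :* (c :- (𝟙 :- n) :+ (n :+ n) :* (𝟙 :- v))) :=
               four :* ((((n :- 𝟙) :* (n :- 𝟙) :- (four :* s :* (n :- s)) :* (v :* v)) :+ (four :* s :* (n :- s)) :* v)
                 :+ ((n :- 𝟙) :* c) :* v)) refl N ν s (c + c′) ⟩
        fromℕ 4 * R s  ∎
      F≈4R {d} {s} (inj₂ (d≈1 , s≈0)) = begin-equality
        F d s * ((1# - ν) + (1# - ν))
          ≈⟨ *-congʳ (F-cong d≈1 s≈0) ⟩
        F 1# 0# * ((1# - ν) + (1# - ν))
          ≈⟨ trans (+-congˡ (z*≈0 _)) (+-identityʳ _) ⟨
        F 1# 0# * ((1# - ν) + (1# - ν)) + (N * ν - 1#) * (fromℕ 4 * ((c + c′) - (1# - N)))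
          ≈⟨ solve 3 (λ n v c →
               ((n :* n :- 𝟙 :* n) :+ (n :* n :- 𝟙 :* n) :+ (c :+ (n :- 𝟙 :* n) :+ (c :+ (n :- 𝟙 :* n)))
                 :- four :* ((𝟘 :* 𝟘 :+ (n :- 𝟙 :* n :- 𝟘) :* (n :- 𝟙 :* n :- 𝟘)) :* v)) :* ((𝟙 :- v) :+ (𝟙 :- v))
               :+ (n :* v :- 𝟙) :* (four :* (c :- (𝟙 :- n))) :=
               four :* ((((n :- 𝟙) :* (n :- 𝟙) :- (four :* 𝟘 :* (n :- 𝟘)) :* (v :* v)) :+ (four :* 𝟘 :* (n :- 𝟘)) :* v)
                 :+ ((n :- 𝟙) :* c) :* v)) refl N ν (c + c′) ⟩
        fromℕ 4 * R 0#
          ≈⟨ *-congˡ (R-cong s≈0) ⟨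
        fromℕ 4 * R s  ∎

      E*[2-2ν]≈4*radicand : E * ((1# - ν) + (1# - ν)) ≈ fromℕ 4 * radicand
      E*[2-2ν]≈4*radicand = trans (*-congʳ E≈) (trans (F≈4R (δ-cases D))
        (*-congˡ (+-congʳ (+-congʳ (+-congˡ (-‿cong (*-congˡ (sym N²⁻¹≈ν²))))))))

    -- Adding the two Cauchy-Schwarz triples before taking roots yields a single root. Only the sums
    -- of the loop and arc numbers of both digraphs and the squares of the loop numbers enter
    -- besides c₂, and the complement determines all of these from `s`.
    spectralRadii-sum-upper : ∀ {ρ ρ′} → IsDigraphSpectralRadius D ρ → IsDigraphSpectralRadius (complement D) ρ′ →
      ∃[ root ] (IsSqrt radicand root × ρ + ρ′ ≤ (1# - d) + root)
    spectralRadii-sum-upper {ρ} {ρ′} isρ isρ′ = root , isRoot , (begin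
      ρ + ρ′                                 ≤⟨ +-mono-≤ ρ≤V ρ′≤V′ ⟩
      V + V′
        ≈⟨ solve 5 (λ V W s t v → V :+ W := (s :+ t) :* v :+ ((V :- s :* v) :+ (W :- t :* v))) refl
             V V′ s s′ ν ⟩
      (s + s′) * ν + U                       ≤⟨ +-mono-≤ (≤-reflexive [s+s′]ν≈1-d) U≤root ⟩
      (1# - d) + root                        ∎)
      where
      upper  = spectralRadius-upper D isρ
      upper′ = spectralRadius-upper (complement D) isρ′

      V V′ U : Carrier
      V  = proj₁ upper
      V′ = proj₁ upper′
      U  = (V - s * ν) + (V′ - s′ * ν)

      ρ≤V   = proj₁ (proj₂ upper)
      ρ′≤V′ = proj₁ (proj₂ upper′)

      cs : IsCauchySchwarz E ((1# - ν) + (1# - ν))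
             (((V - s * ν) + (V - s * ν)) + ((V′ - s′ * ν) + (V′ - s′ * ν)))
      cs = cs-+ (proj₂ (proj₂ upper)) (proj₂ (proj₂ upper′))

      0≤radicand : 0# ≤ radicand
      -- Four times the radicand is E (2 - 2 ν), a product of two sums of squared norms.
      0≤radicand = *-cancelˡ-0≤ (fromℕ-pos 4)
        (≤-respʳ-≈ E*[2-2ν]≈4*radicand (*-nonNeg (proj₁ cs) (proj₁ (proj₂ cs))))

      root : Carrier
      root = proj₁ (sqrt radicand 0≤radicand)

      isRoot : IsSqrt radicand root
      isRoot = proj₂ (sqrt radicand 0≤radicand)

      U≤root : U ≤ root
      -- The products in the triples carry a factor 2, hence (2 U)² ≤ E (2 - 2 ν) = (2 root)².
      U≤root = halve (²-cancel-≤ (+-nonNeg (proj₁ isRoot) (proj₁ isRoot)) (begin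
        (U + U) ²
          ≈⟨ solve 2 (λ x y → ((x :+ y) :+ (x :+ y)) :* ((x :+ y) :+ (x :+ y)) :=
               ((x :+ x) :+ (y :+ y)) :* ((x :+ x) :+ (y :+ y))) refl (V - s * ν) (V′ - s′ * ν) ⟩
        (((V - s * ν) + (V - s * ν)) + ((V′ - s′ * ν) + (V′ - s′ * ν))) ²
          ≤⟨ proj₂ (proj₂ cs) ⟩
        E * ((1# - ν) + (1# - ν))
          ≈⟨ E*[2-2ν]≈4*radicand ⟩
        fromℕ 4 * radicand
          ≈⟨ *-congˡ (proj₂ isRoot) ⟨
        fromℕ 4 * root ²
          ≈⟨ solve 1 (λ r → four :* (r :* r) := (r :+ r) :* (r :+ r)) refl root ⟩
        (root + root) ²  ∎))

lemma5p11 : (ℝ : Reals) (n : ℕ) .{{_ : NonZero n}} (D : Digraph n) →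
    let open Reals ℝ
        open Spectral ℝ
        N  = fromℕ n
        s  = fromℕ (σ D)
        d  = fromℕ (δ D)
        c  = fromℕ (c₂ D)
        c′ = fromℕ (c₂ (complement D))
    in
    (ρ ρ′ : Carrier) →
    IsDigraphSpectralRadius D ρ →
    IsDigraphSpectralRadius (complement D) ρ′ →
    ((1# - d) + (c + c′) / N ≤ ρ + ρ′) ×
    (∃[ root ]
      (IsSqrt ((((N - 1#) ² - (fromℕ 4 * s * (N - s)) / (N ²))
                 + (fromℕ 4 * s * (N - s)) / N)
                 + ((N - 1#) * (c + c′)) / N)
              root
       × (ρ + ρ′ ≤ (1# - d) + root)))
lemma5p11 ℝ n D ρ ρ′ isρ isρ′ = spectralRadii-sum-lower n D isρ isρ′ , spectralRadii-sum-upper n D isρ isρ′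
  where open RadiusBounds ℝ
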